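{- Let $\pi\in S_n$ have LTR-max decomposition $\pi=M_1P_1M_2$ with $M_2\neq\emptyset$, and let $m_1=|M_1|$, $p_1=|P_1|$, $m_2=|M_2|$. Then \[|q^{ -1}(\pi)|=\sum_{i=1}^{m_2}\sum_{j=0}^{i-1}\binom{i-1}{j}\left(\sum_{l=0}^{m_1-2}\left(\!\binom{m_1-l}{j+1}\!\right)b_{m_1-1,l+1}\right)\left(\sum_{k=2}^{m_2-i+1}g_{m_2-i,k}\left(\!\binom{k}{p_1+i-j-1}\!\right)\right),\] where every summation whose index set is empty is taken to equal $1$.
   Context: $S_n$ is the set of permutations of $\{1,\dots,n\}$ in one-line notation. An entry $\pi_i$ is a left-to-right (LTR) maximum if $\pi_i>\pi_j$ for all $j<i$. The map $q:S_n\to S_n$ (the algorithm Queuesort, sorting with a queue allowing bypass): let $m_1,\dots,m_r$ be the LTR maxima of $\pi$ from left to right; for $i=r,\dots,1$ in this order, repeatedly swap $m_i$ with the entry immediately to its right as long as such an entry exists and is smaller than $m_i$; the result is $q(\pi)$. $q^{ -1}(\pi)=\{\sigma: q(\sigma)=\pi\}$. The LTR-max decomposition $\pi=M_1P_1M_2$ means: $M_1$ is the maximal initial factor of consecutive LTR maxima, $P_1$ is a nonempty factor of non-LTR-maxima, and $M_2$ is the final factor consisting of LTR maxima, and these are all the LTR maxima. $S_n(321)$ is the set of $\pi\in S_n$ avoiding $321$ (no $a<b<c$ with $\pi_a>\pi_b>\pi_c$). For $n\ge1$, $1\le i\le n$: $b_{n,i}=|\{\pi\in S_n(321):\pi_i=n\}|$.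 For $n\ge1$, $2\le i\le n$: $g_{n,i}$ is the number of $\pi\in S_n(321)$ such that $\pi_i$ is not an LTR maximum but $\pi_j$ is an LTR maximum for all $j<i$; and $g_{n,n+1}=1$. $\left(\!\binom{u}{v}\!\right)=\binom{u+v-1}{v}$ is the number of multisets of size $v$ from a set of size $u$. -}

module Defs where

open import Data.Bool using (Bool; true; false; _∧_; _∨_; not; if_then_else_; T)
open import Data.Nat using (ℕ; zero; suc; _+_; _*_; _∸_; _≤_; _<_; _<ᵇ_; _≡ᵇ_)
open import Data.Nat.Combinatorics using (_C_)
open import Relation.Binary.PropositionalEquality using (_≡_)
open import Data.List using (List; []; _∷_; length; filterᵇ; applyUpTo; concatMap; map; foldl; reverse)
open import Data.Bool.ListAction using (all; any)
open import Data.Nat.ListAction using (sum)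

-- 1-indexed access into a list (returns 0 out of range)
at : List ℕ → ℕ → ℕ
at [] _ = 0
at (x ∷ xs) 0 = 0
at (x ∷ xs) 1 = x
at (x ∷ xs) (suc (suc i)) = at xs (suc i)

range : ℕ → ℕ → List ℕ
range a b = applyUpTo (λ k → a + k) (suc b ∸ a)

count : {A : Set} → (A → Bool) → List A → ℕ
count p xs = length (filterᵇ p xs)

words : ℕ → ℕ → List (List ℕ)
words n zero = [] ∷ []
words n (suc k) = concatMap (λ x → map (x ∷_) (words n k)) (range 1 n)

isPerm : ℕ → List ℕ → Bool
isPerm n π = (length π ≡ᵇ n) ∧ all (λ v → any (λ x → x ≡ᵇ v) π) (range 1 n)

-- S_n as the (complete, duplicate-free) list of all permutations of {1..n}
Sn : ℕ → List (List ℕ)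
Sn n = filterᵇ (isPerm n) (words n n)

isLTRmax : List ℕ → ℕ → Bool
isLTRmax π i = all (λ j → at π j <ᵇ at π i) (range 1 (i ∸ 1))

ltrMaxima : List ℕ → List ℕ
ltrMaxima π = map (at π) (filterᵇ (isLTRmax π) (range 1 (length π)))

slide : ℕ → List ℕ → List ℕ
slide v [] = v ∷ []
slide v (y ∷ ys) = if y <ᵇ v then y ∷ slide v ys else v ∷ y ∷ ys

push : ℕ → List ℕ → List ℕ
push v [] = []
push v (x ∷ xs) = if x ≡ᵇ v then slide v xs else x ∷ push v xs

-- Queuesort: process m_r, ..., m_1 in this order
q : List ℕ → List ℕ
q π = foldl (λ acc m → push m acc) π (reverse (ltrMaxima π))

listEq : List ℕ → List ℕ → Bool
listEq [] [] = true
listEq [] (_ ∷ _) = false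
listEq (_ ∷ _) [] = false
listEq (x ∷ xs) (y ∷ ys) = (x ≡ᵇ y) ∧ listEq xs ys

preimageCount : ℕ → List ℕ → ℕ
preimageCount n π = count (λ σ → listEq (q σ) π) (Sn n)

avoids321 : ℕ → List ℕ → Bool
avoids321 n π = not (any (λ a → any (λ b → any (λ c →
  (at π b <ᵇ at π a) ∧ (at π c <ᵇ at π b)) (range (suc b) n)) (range (suc a) n)) (range 1 n))

Sn321 : ℕ → List (List ℕ)
Sn321 n = filterᵇ (avoids321 n) (Sn n)

bb : ℕ → ℕ → ℕ
bb n i = count (λ π → at π i ≡ᵇ n) (Sn321 n)

-- g_{n,i} for 2 ≤ i ≤ n, and g_{n,n+1} = 1
gg : ℕ → ℕ → ℕ
gg n i = if i ≡ᵇ suc n then 1 else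
  count (λ π → not (isLTRmax π i) ∧ all (isLTRmax π) (range 1 (i ∸ 1))) (Sn321 n)

multichoose : ℕ → ℕ → ℕ
multichoose u v = (u + v ∸ 1) C v

-- ΣE a c f = Σ_{k=a}^{c-1} f k  (upper bound exclusive, so that bounds like
-- m₁-2 < 0 are handled without truncated subtraction), with the convention that
-- a summation over an empty index set equals 1
ΣE : ℕ → ℕ → (ℕ → ℕ) → ℕ
ΣE a c f = if a <ᵇ c then sum (map f (range a (c ∸ 1))) else 1

record LTRDecomp (π : List ℕ) (m₁ p₁ m₂ : ℕ) : Set where
  field
    len   : length π ≡ m₁ + p₁ + m₂
    p₁>0  : 1 ≤ p₁
    ltr-M₁ : ∀ i → 1 ≤ i → i ≤ m₁ → T (isLTRmax π i)
    nonltr-P₁ : ∀ i → m₁ < i → i ≤ m₁ + p₁ → T (not (isLTRmax π i))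
    ltr-M₂ : ∀ i → m₁ + p₁ < i → i ≤ m₁ + p₁ + m₂ → T (isLTRmax π i)

rhs : ℕ → ℕ → ℕ → ℕ
rhs m₁ p₁ m₂ = ΣE 1 (m₂ + 1) λ i → ΣE 0 i λ j →
  ((i ∸ 1) C j)
  * ΣE 0 (m₁ ∸ 1) (λ l → multichoose (m₁ ∸ l) (suc j) * bb (m₁ ∸ 1) (suc l))
  * ΣE 2 (m₂ + 2 ∸ i) (λ k → gg (m₂ ∸ i) k * multichoose k (p₁ + i ∸ j ∸ 1))

{-# OPTIONS --safe #-}
module Submission where

-- Queuesort reads its input with a queue: a left-to-right maximum enters the queue,
-- and any other letter x bypasses it after the queued letters below x have left.
-- Reversing this, the preimages of π are generated from a list of pending letters,
-- still to bypass the queue, and the remaining letters of π: at each step either the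
-- first pending letter bypasses the queue, or some remaining letter y enters it and
-- the remaining letters before y become pending. Exactly the left-to-right maxima of
-- π followed by a larger letter (or last in π) can enter; with μ the last letter of
-- M₁ these are all letters outside μ P₁. So |q⁻¹(π)| satisfies a recursion in the
-- numbers of pending and remaining letters. For the identity the same process
-- generates S_n(321), which turns b and g into refined counts of it: by the position
-- of n, and by the number of letters that enter before the first bypass. Cutting a
-- run where μ bypasses the queue gives the formula: the last letter that has entered
-- is then the i-th of M₂, and j of the i − 1 letters of M₂ before it have entered too.

open import Defs
open import Data.Bool using (Bool; true; false; T; _∧_; not; if_then_else_)
open import Data.Bool.ListAction using (all; any)
open import Data.Bool.Properties using (T-≡; T-∧; T-not-≡; ∧-zeroʳ; ∧-identityʳ)
open import Data.List hiding (sum; all; any; product; find)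
open import Data.List.Membership.Propositional using (_∈_; _∉_; lose; find)
open import Data.List.Membership.Propositional.Properties
open import Data.List.Membership.Propositional.Properties.WithK using (unique∧set⇒bag)
open import Data.List.Properties
  using (length-++; length-map; length-applyUpTo; applyUpTo-∷ʳ; ∷ʳ-++; ++-assoc; ++-identityʳ;
         ∷-injective; ∷-injectiveˡ; ∷-injectiveʳ; foldr-∷ʳ; reverse-foldl)
open import Data.List.Relation.Binary.BagAndSetEquality using (∼bag⇒↭)
open import Data.List.Relation.Binary.Disjoint.Propositional using (Disjoint)
open import Data.List.Relation.Binary.Permutation.Propositional
  using (_↭_; ↭-refl; ↭-sym; ↭-trans; prep; ↭⇒↭ₛ)
open import Data.List.Relation.Binary.Permutation.Propositional.Properties
  using (shift; ↭-length; ∈-resp-↭; All-resp-↭; drop-∷; drop-mid; filter-↭; ↭-empty-inv)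
import Data.List.Relation.Binary.Permutation.Setoid.Properties as PermutationSetoid
open import Data.List.Relation.Ternary.Interleaving.Propositional
  using (Interleaving; []; consˡ; consʳ; toPermutation)
open import Data.List.Relation.Unary.All as All using (All; []; _∷_)
import Data.List.Relation.Unary.All.Properties as All
open import Data.List.Relation.Unary.AllPairs as AllPairs using (AllPairs; []; _∷_)
import Data.List.Relation.Unary.AllPairs.Properties as AllPairs
open import Data.List.Relation.Unary.Any using (Any; here; there)
import Data.List.Relation.Unary.Any.Properties as Any
open import Data.List.Relation.Unary.Linked as Linked using (Linked; []; [-]; _∷_)
import Data.List.Relation.Unary.Linked.Properties as Linked
open import Data.List.Relation.Unary.Unique.Propositional using (Unique)
import Data.List.Relation.Unary.Unique.Propositional.Properties as Unique
open import Data.Maybe.Relation.Unary.All as Maybe using (just; nothing)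
open import Data.Nat
open import Data.Nat.Combinatorics using (_C_; nCk+nC[k+1]≡[n+1]C[k+1]; nCn≡1; k>n⇒nCk≡0)
open import Data.Nat.ListAction using (sum)
open import Data.Nat.Properties hiding (_≟_)
open import Data.List.Membership.DecPropositional _≟_ using (_∈?_)
open import Data.Nat.Tactic.RingSolver using (solve-∀)
open import Data.Product using (_×_; _,_; proj₁; proj₂; ∃)
open import Data.Sum using (_⊎_; inj₁; inj₂)
open import Function using (_∘_; id; flip; Equivalence; mk⇔)
open import Level using (Level)
open import Relation.Binary using (Rel)
open import Relation.Binary.PropositionalEquality
open import Relation.Nullary using (¬_; yes; no; contradiction; does; T?)
open import Relation.Nullary.Decidable using (dec-true; dec-false)

open Equivalence using (to; from)
open ≡-Reasoning

private
  variable
    a ℓ : Level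
    A : Set a
    R : Rel A ℓ

-- Sums and counting recursions

Σ< : ℕ → (ℕ → ℕ) → ℕ
Σ< zero    f = 0
Σ< (suc n) f = f 0 + Σ< n (f ∘ suc)

sum-map-applyUpTo : ∀ (f g : ℕ → ℕ) n → sum (map f (applyUpTo g n)) ≡ Σ< n (f ∘ g)
sum-map-applyUpTo f g zero    = refl
sum-map-applyUpTo f g (suc n) = cong (f (g 0) +_) (sum-map-applyUpTo f (g ∘ suc) n)

Σ<-cong< : ∀ n {f g : ℕ → ℕ} → (∀ i → i < n → f i ≡ g i) → Σ< n f ≡ Σ< n g
Σ<-cong< zero    f≗g = refl
Σ<-cong< (suc n) f≗g = cong₂ _+_ (f≗g 0 z<s) (Σ<-cong< n λ i i<n → f≗g (suc i) (s<s i<n))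

Σ<-cong : ∀ n {f g : ℕ → ℕ} → (∀ i → f i ≡ g i) → Σ< n f ≡ Σ< n g
Σ<-cong n f≗g = Σ<-cong< n λ i _ → f≗g i

Σ<-zero : ∀ n → Σ< n (λ _ → 0) ≡ 0
Σ<-zero zero    = refl
Σ<-zero (suc n) = Σ<-zero n

+-interchange : ∀ a b c d → (a + b) + (c + d) ≡ (a + c) + (b + d)
+-interchange = solve-∀

Σ<-+ : ∀ n (f g : ℕ → ℕ) → Σ< n (λ i → f i + g i) ≡ Σ< n f + Σ< n g
Σ<-+ zero    f g = refl
Σ<-+ (suc n) f g = trans (cong (f 0 + g 0 +_) (Σ<-+ n (f ∘ suc) (g ∘ suc)))
                         (+-interchange (f 0) (g 0) _ _)

Σ<-last : ∀ n (f : ℕ → ℕ) → Σ< (suc n) f ≡ Σ< n f + f n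
Σ<-last zero    f = +-comm (f 0) 0
Σ<-last (suc n) f = trans (cong (f 0 +_) (Σ<-last n (f ∘ suc))) (sym (+-assoc (f 0) _ _))

pascal : ∀ n k → suc n C suc k ≡ n C k + n C suc k
pascal n k = sym (nCk+nC[k+1]≡[n+1]C[k+1] n k)

-- comp c r counts the runs with c pending and r remaining letters when every remaining
-- letter can enter the queue; comp′ counts those in which a letter enters next.
mutual
  comp : ℕ → ℕ → ℕ
  comp zero    zero    = 1
  comp zero    (suc r) = comp′ zero (suc r)
  comp (suc c) r       = comp c r + comp′ (suc c) r

  comp′ : ℕ → ℕ → ℕ
  comp′ c zero    = 0
  comp′ c (suc r) = comp c r + comp′ (suc c) r

-- The same counts for M₁ P₁ M₂ as long as no letter of M₂ has entered: only the
-- r remaining letters of M₁ before μ can enter, d = |μ P₁| and m = |M₂|.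
module Pivot (d m : ℕ) where
  mutual
    U : ℕ → ℕ → ℕ
    U zero    r = U′ zero r
    U (suc c) r = U c r + U′ (suc c) r

    U′ : ℕ → ℕ → ℕ
    U′ c zero    = comp′ (c + d) m
    U′ c (suc r) = U c r + U′ (suc c) r

-- The recursion step for the next letter to enter the queue.
skips : (ℕ → ℕ → ℕ) → ℕ → ℕ → ℕ
skips F c zero    = 0
skips F c (suc r) = F c r + skips F (suc c) r

down : (ℕ → ℕ → ℕ) → ℕ → ℕ → ℕ
down F zero    r = 0
down F (suc c) r = F c r

-- The runs counted by comp c r whose letter number i (from 0) is the largest one.
maxAt : ℕ → ℕ → ℕ → ℕ
maxAt i       c zero    = 0
maxAt zero    c (suc r) = 1
maxAt (suc i) c (suc r) = down (maxAt i) c (suc r) + skips (maxAt i) c (suc r)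

-- The runs counted by comp c r in which exactly k letters enter before the first bypass.
dropAt : ℕ → ℕ → ℕ → ℕ
dropAt zero    zero    zero    = 1
dropAt zero    zero    (suc r) = 0
dropAt zero    (suc c) r       = comp c r
dropAt (suc k) c       r       = skips (dropAt k) c r

dropAt-zero : ∀ k c r → r < k → dropAt k c r ≡ 0
skips-dropAt-zero : ∀ k c r → r ≤ k → skips (dropAt k) c r ≡ 0
dropAt-zero (suc k) c r (s≤s r≤k) = skips-dropAt-zero k c r r≤k
skips-dropAt-zero k c zero    r≤k   = refl
skips-dropAt-zero k c (suc r) r<k   =
  cong₂ _+_ (dropAt-zero k c r r<k) (skips-dropAt-zero k (suc c) r (<⇒≤ r<k))

-- With nothing pending, skipping a letter leaves fewer than `r` letters to enter. This value
-- matches the convention that g at (n, n+1) is 1.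
dropAt-top : ∀ r → dropAt r 0 r ≡ 1
dropAt-top zero    = refl
dropAt-top (suc r) = cong₂ _+_ (dropAt-top r) (skips-dropAt-zero r 1 r ≤-refl)

C-step : ∀ k x → (suc k + suc x) C suc x ≡ (suc k + x) C x + (k + suc x) C suc x
C-step k x = trans (pascal (k + suc x) x) (cong (λ n → n C x + (k + suc x) C suc x) (+-suc k x))

-- Among c = x + y pending letters the first x ones may be interleaved freely with
-- the k letters entering the queue before the first of the other y bypasses it.
comp-dropAt  : ∀ r x y N → r < N → comp (x + y) r ≡ Σ< N (λ k → dropAt k y r * ((k + x) C x))
comp′-dropAt : ∀ r x y N → r ≤ N → comp′ (x + y) r ≡ Σ< N (λ k → skips (dropAt k) y r * ((k + x) C x))

comp-dropAt r zero y (suc N) (s≤s r≤N) = begin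
  comp y r
    ≡⟨ split y r ⟩
  dropAt 0 y r + comp′ y r
    ≡⟨ cong₂ _+_ (sym (*-identityʳ _)) (comp′-dropAt r 0 y N r≤N) ⟩
  dropAt 0 y r * 1 + Σ< N (λ k → skips (dropAt k) y r * ((k + 0) C 0)) ∎
  where
  split : ∀ y r → comp y r ≡ dropAt 0 y r + comp′ y r
  split zero    zero    = refl
  split zero    (suc r) = refl
  split (suc y) r       = refl
comp-dropAt r (suc x) y (suc N) (s≤s r≤N) = begin
  comp (x + y) r + comp′ (suc x + y) r
    ≡⟨ cong₂ _+_ (comp-dropAt r x y (suc N) (s≤s r≤N)) (comp′-dropAt r (suc x) y N r≤N) ⟩
  (dropAt 0 y r * (x C x) + Σ< N (λ k → s k * ((suc k + x) C x)))
    + Σ< N (λ k → s k * ((k + suc x) C suc x))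
    ≡⟨ +-assoc (dropAt 0 y r * (x C x)) _ _ ⟩
  dropAt 0 y r * (x C x) + (Σ< N (λ k → s k * ((suc k + x) C x))
    + Σ< N (λ k → s k * ((k + suc x) C suc x)))
    -- In the term `k = 0` no letter enters before the first bypass, so there is nothing to
    -- interleave and both binomials are 1.
    ≡⟨ cong₂ (λ u v → dropAt 0 y r * u + v) (trans (nCn≡1 x) (sym (nCn≡1 (suc x)))) (sym (Σ<-+ N _ _)) ⟩
  dropAt 0 y r * (suc x C suc x)
    + Σ< N (λ k → s k * ((suc k + x) C x) + s k * ((k + suc x) C suc x))
    ≡⟨ cong (dropAt 0 y r * (suc x C suc x) +_) (Σ<-cong N λ k →
         trans (sym (*-distribˡ-+ (s k) _ _)) (cong (s k *_) (sym (C-step k x)))) ⟩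
  dropAt 0 y r * (suc x C suc x) + Σ< N (λ k → s k * ((suc k + suc x) C suc x)) ∎
  where
  s : ℕ → ℕ
  s k = skips (dropAt k) y r

comp′-dropAt zero    x y N r≤N = sym (Σ<-zero N)
comp′-dropAt (suc r) x y N r<N = begin
  comp (x + y) r + comp′ (suc (x + y)) r
    ≡⟨ cong (λ c → comp (x + y) r + comp′ c r) (sym (+-suc x y)) ⟩
  comp (x + y) r + comp′ (x + suc y) r
    ≡⟨ cong₂ _+_ (comp-dropAt r x y N r<N) (comp′-dropAt r x (suc y) N (<⇒≤ r<N)) ⟩
  Σ< N (λ k → dropAt k y r * ((k + x) C x)) + Σ< N (λ k → skips (dropAt k) (suc y) r * ((k + x) C x))
    ≡⟨ sym (Σ<-+ N _ _) ⟩
  Σ< N (λ k → dropAt k y r * ((k + x) C x) + skips (dropAt k) (suc y) r * ((k + x) C x))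
    ≡⟨ Σ<-cong N (λ k → sym (*-distribʳ-+ ((k + x) C x) (dropAt k y r) _)) ⟩
  Σ< N (λ k → skips (dropAt k) y (suc r) * ((k + x) C x)) ∎

-- A recursive form of the double sum of the theorem, see weigh-explicit: the first
-- letter of M₂ enters last before μ bypasses, or becomes pending, or enters earlier.
weigh : (ℕ → ℕ) → ℕ → ℕ → ℕ
weigh f p zero    = 0
weigh f p (suc m) = f 0 * comp p m + (weigh f (suc p) m + weigh (f ∘ suc) p m)

weigh-cong : ∀ {f g : ℕ → ℕ} → (∀ j → f j ≡ g j) → ∀ p m → weigh f p m ≡ weigh g p m
weigh-cong f≗g p zero    = refl
weigh-cong f≗g p (suc m) = cong₂ _+_ (cong (_* comp p m) (f≗g 0))
  (cong₂ _+_ (weigh-cong f≗g (suc p) m) (weigh-cong (f≗g ∘ suc) p m))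

weigh-zero : ∀ p m → weigh (λ _ → 0) p m ≡ 0
weigh-zero p zero    = refl
weigh-zero p (suc m) = cong₂ _+_ (weigh-zero (suc p) m) (weigh-zero p m)

weigh-+ : ∀ f g p m → weigh (λ j → f j + g j) p m ≡ weigh f p m + weigh g p m
weigh-+ f g p zero    = refl
weigh-+ f g p (suc m) = trans
  (cong₂ _+_ (*-distribʳ-+ (comp p m) (f 0) (g 0))
    (cong₂ _+_ (weigh-+ f g (suc p) m) (weigh-+ (f ∘ suc) (g ∘ suc) p m)))
  (shuffle (f 0 * comp p m) (g 0 * comp p m)
    (weigh f (suc p) m) (weigh g (suc p) m) (weigh (f ∘ suc) p m) (weigh (g ∘ suc) p m))
  where
  shuffle : ∀ a b c d e h → (a + b) + ((c + d) + (e + h)) ≡ (a + (c + e)) + (b + (d + h))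
  shuffle = solve-∀

weigh-* : ∀ k f p m → weigh (λ j → k * f j) p m ≡ k * weigh f p m
weigh-* k f p zero    = sym (*-zeroʳ k)
weigh-* k f p (suc m) = trans
  (cong₂ _+_ (*-assoc k (f 0) (comp p m)) (cong₂ _+_ (weigh-* k f (suc p) m) (weigh-* k (f ∘ suc) p m)))
  (factor k (f 0 * comp p m) _ _)
  where
  factor : ∀ k a b c → k * a + (k * b + k * c) ≡ k * (a + (b + c))
  factor = solve-∀

weigh-Σ : ∀ n (F : ℕ → ℕ → ℕ) p m → Σ< n (λ i → weigh (F i) p m) ≡ weigh (λ j → Σ< n (λ i → F i j)) p m
weigh-Σ zero    F p m = sym (weigh-zero p m)
weigh-Σ (suc n) F p m = trans (cong (weigh (F 0) p m +_) (weigh-Σ n (F ∘ suc) p m))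
                              (sym (weigh-+ (F 0) _ p m))

-- The sum over j of the theorem, unrolled by Pascal's rule: each of the `i` letters either becomes
-- pending, raising `p`, or enters, shifting `f`.
binomialSum : (ℕ → ℕ) → (ℕ → ℕ) → ℕ → ℕ → ℕ
binomialSum f g p zero    = f 0 * g p
binomialSum f g p (suc i) = binomialSum f g (suc p) i + binomialSum (f ∘ suc) g p i

binomialSum-explicit : ∀ f g p i →
  Σ< (suc i) (λ j → (i C j) * f j * g (p + i ∸ j)) ≡ binomialSum f g p i
binomialSum-explicit f g p zero    = begin
  1 * f 0 * g (p + 0) + 0 ≡⟨ +-identityʳ _ ⟩
  1 * f 0 * g (p + 0)     ≡⟨ cong₂ _*_ (*-identityˡ (f 0)) (cong g (+-identityʳ p)) ⟩
  f 0 * g p               ∎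
binomialSum-explicit f g p (suc i) rewrite +-suc p i = begin
  1 * f 0 * g (suc (p + i)) + Σ< (suc i) (λ j → (suc i C suc j) * f (suc j) * g (p + i ∸ j))
    ≡⟨ cong (first +_) (Σ<-cong (suc i) λ j → trans
         (cong (λ c → c * f (suc j) * g (p + i ∸ j)) (pascal i j))
         (expand (i C j) (i C suc j) (f (suc j)) _)) ⟩
  first + Σ< (suc i) (λ j → (i C j) * f (suc j) * g (p + i ∸ j) + h (suc j))
    ≡⟨ cong (first +_) (Σ<-+ (suc i) (λ j → (i C j) * f (suc j) * g (p + i ∸ j)) (h ∘ suc)) ⟩
  first + (Σ< (suc i) (λ j → (i C j) * f (suc j) * g (p + i ∸ j)) + Σ< (suc i) (h ∘ suc))
    -- The term `j = 0` is `h 0`, so it completes the sum belonging to `suc p`.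
    ≡⟨ rotate first _ _ ⟩
  Σ< (suc (suc i)) h + Σ< (suc i) (λ j → (i C j) * f (suc j) * g (p + i ∸ j))
    ≡⟨ cong₂ _+_ dropLast (binomialSum-explicit (f ∘ suc) g p i) ⟩
  binomialSum f g (suc p) i + binomialSum (f ∘ suc) g p i ∎
  where
  first : ℕ
  first = 1 * f 0 * g (suc (p + i))

  h : ℕ → ℕ
  h j = (i C j) * f j * g (suc p + i ∸ j)

  expand : ∀ a b x y → (a + b) * x * y ≡ a * x * y + b * x * y
  expand = solve-∀

  rotate : ∀ a b c → a + (b + c) ≡ (a + c) + b
  rotate = solve-∀

  dropLast : Σ< (suc (suc i)) h ≡ binomialSum f g (suc p) i
  dropLast = begin
    Σ< (suc (suc i)) h         ≡⟨ Σ<-last (suc i) h ⟩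
    Σ< (suc i) h + h (suc i)   ≡⟨ cong (λ c → Σ< (suc i) h + c * f (suc i) * g (suc p + i ∸ suc i))
                                    (k>n⇒nCk≡0 (n<1+n i)) ⟩
    Σ< (suc i) h + 0           ≡⟨ +-identityʳ _ ⟩
    Σ< (suc i) h               ≡⟨ binomialSum-explicit f g (suc p) i ⟩
    binomialSum f g (suc p) i  ∎

-- Here `i` is the number of letters of M₂ before the last one to enter, and `m ∸ suc i` letters
-- remain after it. The term `i = 0` is split off, and the others divide by the fate of the first
-- letter.
weigh-explicit : ∀ f p m → Σ< m (λ i → binomialSum f (λ x → comp x (m ∸ suc i)) p i) ≡ weigh f p m
weigh-explicit f p zero    = refl
weigh-explicit f p (suc m) = cong (f 0 * comp p m +_) (trans (Σ<-+ m _ _)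
  (cong₂ _+_ (weigh-explicit f (suc p) m) (weigh-explicit (f ∘ suc) p m)))

-- A run is cut at the bypass of pending letter number `a`. If no letter has entered by then,
-- `comp p m` runs are left. Otherwise `j + 1` letters have entered, and their moments are chosen
-- among the `a + j` steps before the cut. In `comp′-weigh` the cut is at number `suc a` and the
-- first step is an entry, so only `j` entries are chosen among the `a + j` steps between.
mutual
  comp-weigh : ∀ a p m → comp (a + p) m ≡ comp p m + weigh (λ j → (a + j) C suc j) p m
  comp-weigh zero    p m = sym (trans
    (cong (comp p m +_) (trans (weigh-cong (λ j → k>n⇒nCk≡0 (n<1+n j)) p m) (weigh-zero p m)))
    (+-identityʳ (comp p m)))
  comp-weigh (suc a) p m = begin
    comp (a + p) m + comp′ (suc a + p) m
      ≡⟨ cong₂ _+_ (comp-weigh a p m) (comp′-weigh a p m) ⟩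
    comp p m + weigh (λ j → (a + j) C suc j) p m + weigh (λ j → (a + j) C j) p m
      ≡⟨ swap-last (comp p m) _ _ ⟩
    comp p m + (weigh (λ j → (a + j) C j) p m + weigh (λ j → (a + j) C suc j) p m)
      ≡⟨ cong (comp p m +_) (sym (weigh-+ (λ j → (a + j) C j) (λ j → (a + j) C suc j) p m)) ⟩
    comp p m + weigh (λ j → (a + j) C j + (a + j) C suc j) p m
      ≡⟨ cong (comp p m +_) (weigh-cong (λ j → sym (pascal (a + j) j)) p m) ⟩
    comp p m + weigh (λ j → (suc a + j) C suc j) p m ∎
    where
    swap-last : ∀ a b c → a + b + c ≡ a + (c + b)
    swap-last = solve-∀

  comp′-weigh : ∀ a p m → comp′ (suc a + p) m ≡ weigh (λ j → (a + j) C j) p m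
  comp′-weigh a p zero    = refl
  comp′-weigh a p (suc m) = begin
    comp (suc a + p) m + comp′ (suc (suc a) + p) m
      ≡⟨ cong (λ c → comp (suc a + p) m + comp′ (suc c) m) (sym (+-suc a p)) ⟩
    comp (suc a + p) m + comp′ (suc a + suc p) m
      ≡⟨ cong₂ _+_ (comp-weigh (suc a) p m) (comp′-weigh a (suc p) m) ⟩
    (comp p m + weigh (λ j → (suc a + j) C suc j) p m) + weigh (λ j → (a + j) C j) (suc p) m
      ≡⟨ swap-last (comp p m) _ _ ⟩
    comp p m + (weigh (λ j → (a + j) C j) (suc p) m + weigh (λ j → (suc a + j) C suc j) p m)
      ≡⟨ cong₂ (λ u v → u + (weigh (λ j → (a + j) C j) (suc p) m + v)) (sym (*-identityˡ (comp p m)))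
           (weigh-cong (λ j → cong (_C suc j) (sym (+-suc a j))) p m) ⟩
    weigh (λ j → (a + j) C j) p (suc m) ∎
    where
    swap-last : ∀ a b c → (a + b) + c ≡ a + (c + b)
    swap-last = solve-∀

module _ (p m : ℕ) where
  open Pivot (suc p) m

  -- Compared with `comp-weigh` for `suc c` letters, the ones pending and μ, the summand `comp p m`
  -- is missing: μ becomes pending only when a letter of M₂ enters, so it cannot bypass before that.
  U-base : ∀ c → U c 0 ≡ weigh (λ j → (suc c + j) C suc j) p m
  U-base zero    = trans (comp′-weigh 0 p m)
    (weigh-cong (λ j → trans (nCn≡1 j) (sym (nCn≡1 (suc j)))) p m)
  U-base (suc c) = begin
    U c 0 + comp′ (suc c + suc p) m
      ≡⟨ cong₂ _+_ (U-base c) (trans (cong (λ x → comp′ (suc x) m) (+-suc c p)) (comp′-weigh (suc c) p m)) ⟩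
    weigh (λ j → (suc c + j) C suc j) p m + weigh (λ j → (suc c + j) C j) p m
      ≡⟨ +-comm _ (weigh (λ j → (suc c + j) C j) p m) ⟩
    weigh (λ j → (suc c + j) C j) p m + weigh (λ j → (suc c + j) C suc j) p m
      ≡⟨ sym (weigh-+ (λ j → (suc c + j) C j) (λ j → (suc c + j) C suc j) p m) ⟩
    weigh (λ j → (suc c + j) C j + (suc c + j) C suc j) p m
      ≡⟨ weigh-cong (λ j → sym (pascal (suc c + j) j)) p m ⟩
    weigh (λ j → (suc (suc c) + j) C suc j) p m ∎

maxAt-zero : ∀ i c → maxAt i c 0 ≡ 0
maxAt-zero zero    c = refl
maxAt-zero (suc i) c = refl

module _ (d m : ℕ) where
  open Pivot d m

  -- n ∸ i ∸ 1 letters are pending once the last letter of M₁ before μ has entered;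
  -- the weight U (n ∸ i) 0 also covers the case that this letter becomes pending.
  conv : ℕ → (ℕ → ℕ) → ℕ
  conv n F = Σ< n (λ i → F i * U (n ∸ i) 0)

  conv-+ : ∀ n F G → conv n (λ i → F i + G i) ≡ conv n F + conv n G
  conv-+ n F G = trans (Σ<-cong n λ i → *-distribʳ-+ (U (n ∸ i) 0) (F i) (G i)) (Σ<-+ n _ _)

  conv-zero : ∀ n {F} → (∀ i → F i ≡ 0) → conv n F ≡ 0
  conv-zero n F≗0 = trans (Σ<-cong n λ i → cong (_* U (n ∸ i) 0) (F≗0 i)) (Σ<-zero n)

  -- In a run counted by `comp` everything after the largest letter is forced, so `maxAt i` counts
  -- the ways to make the `i` steps before it. Such a beginning is followed here by what `U` counts
  -- once no letter of M₁ before μ remains. The separate summand of `U′-conv` is the case `i = 0`,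
  -- where all remaining letters but the last are skipped at once.
  U-conv  : ∀ c r → U c (suc r) ≡ conv (c + suc r) (λ i → maxAt i c (suc r))
  U′-conv : ∀ c r → U′ c (suc r) ≡ U (c + suc r) 0 + conv (c + r) (λ i → skips (maxAt i) c (suc r))

  U-conv zero    r = trans (U′-conv zero r) (cong (_+ conv r (λ i → skips (maxAt i) 0 (suc r))) (sym (*-identityˡ (U (suc r) 0))))
  U-conv (suc c) r = begin
    U c (suc r) + U′ (suc c) (suc r)
      ≡⟨ cong₂ _+_ (U-conv c r) (U′-conv (suc c) r) ⟩
    conv (c + suc r) D + (u + conv (suc c + r) S)
      ≡⟨ cong (λ n → conv (c + suc r) D + (u + conv n S)) (sym (+-suc c r)) ⟩
    conv (c + suc r) D + (u + conv (c + suc r) S)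
      ≡⟨ rotate (conv (c + suc r) D) u _ ⟩
    u + (conv (c + suc r) D + conv (c + suc r) S)
      ≡⟨ cong₂ _+_ (sym (*-identityˡ u)) (sym (conv-+ (c + suc r) D S)) ⟩
    conv (suc c + suc r) (λ i → maxAt i (suc c) (suc r)) ∎
    where
    u : ℕ
    u = U (suc c + suc r) 0

    D S : ℕ → ℕ
    D i = maxAt i c (suc r)
    S i = skips (maxAt i) (suc c) (suc r)

    rotate : ∀ a b c → a + (b + c) ≡ b + (a + c)
    rotate = solve-∀

  U′-conv c zero    = begin
    U c 0 + comp′ (suc c + d) m
      ≡⟨⟩
    U (suc c) 0
      ≡⟨ cong (λ n → U n 0) (+-comm 1 c) ⟩
    U (c + 1) 0
      ≡⟨ sym (+-identityʳ _) ⟩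
    U (c + 1) 0 + 0
      ≡⟨ cong (U (c + 1) 0 +_) (sym (conv-zero (c + 0) λ i → cong (_+ 0) (maxAt-zero i c))) ⟩
    U (c + 1) 0 + conv (c + 0) (λ i → skips (maxAt i) c 1) ∎
  U′-conv c (suc r) = begin
    U c (suc r) + U′ (suc c) (suc r)
      ≡⟨ cong₂ _+_ (U-conv c r) (U′-conv (suc c) r) ⟩
    conv (c + suc r) F + (U (suc c + suc r) 0 + conv (suc c + r) G)
      ≡⟨ cong₂ (λ x y → conv (c + suc r) F + (U x 0 + conv y G))
           (sym (+-suc c (suc r))) (sym (+-suc c r)) ⟩
    conv (c + suc r) F + (U (c + suc (suc r)) 0 + conv (c + suc r) G)
      ≡⟨ rotate (conv (c + suc r) F) _ (conv (c + suc r) G) ⟩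
    U (c + suc (suc r)) 0 + (conv (c + suc r) F + conv (c + suc r) G)
      ≡⟨ cong (U (c + suc (suc r)) 0 +_) (sym (conv-+ (c + suc r) F G)) ⟩
    U (c + suc (suc r)) 0 + conv (c + suc r) (λ i → skips (maxAt i) c (suc (suc r))) ∎
    where
    F G : ℕ → ℕ
    F i = maxAt i c (suc r)
    G i = skips (maxAt i) (suc c) (suc r)

    rotate : ∀ a b c → a + (b + c) ≡ b + (a + c)
    rotate = solve-∀

-- The right-hand side of the formula

ΣE-0 : ∀ c f → ΣE 0 (suc c) f ≡ Σ< (suc c) f
ΣE-0 c f = sum-map-applyUpTo f (0 +_) (suc c)

ΣE-1 : ∀ c f → ΣE 1 (suc c + 1) f ≡ Σ< (suc c) (f ∘ suc)
ΣE-1 c f rewrite +-comm c 1 = sum-map-applyUpTo f (1 +_) (suc c)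

ΣE-2 : ∀ c f → ΣE 2 (suc c + 2) f ≡ Σ< (suc c) (f ∘ suc ∘ suc)
ΣE-2 c f rewrite +-comm c 2 = sum-map-applyUpTo f (2 +_) (suc c)

-- The readings of b and g as counts of runs enter as parameters; they are established with the
-- 321-avoiding permutations below.
module _
  (bb≡maxAt  : ∀ n i → i < n → bb n (suc i) ≡ maxAt i 0 n)
  (gg≡dropAt : ∀ n k → k < n → gg n (suc (suc k)) ≡ dropAt (suc k) 0 n)
  where

  ΣE-gg : ∀ n x → ΣE 2 (n + 2) (λ k → gg n k * multichoose k x) ≡ comp x n
  -- For `n = 0` the sum is empty, and its value 1 by convention is the number of runs with no
  -- remaining letters.
  ΣE-gg zero    zero    = refl
  ΣE-gg zero    (suc x) = trans (ΣE-gg zero x) (sym (+-identityʳ (comp x 0)))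
  ΣE-gg (suc n) x = begin
    ΣE 2 (suc n + 2) (λ k → gg (suc n) k * multichoose k x)
      ≡⟨ ΣE-2 n _ ⟩
    Σ< (suc n) (λ k → gg (suc n) (suc (suc k)) * ((suc k + x) C x))
      ≡⟨ Σ<-cong< (suc n) (λ k k<n → cong (_* ((suc k + x) C x)) (gg≡dropAt (suc n) k k<n)) ⟩
    Σ< (suc n) (λ k → dropAt (suc k) 0 (suc n) * ((suc k + x) C x))
      -- All `x` pending letters are interleaved freely. The added summand `k = 0` vanishes, because
      -- `dropAt 0 0 (suc n)` is 0.
      ≡⟨ sym (comp-dropAt (suc n) x 0 (suc (suc n)) ≤-refl) ⟩
    comp (x + 0) (suc n)
      ≡⟨ cong (λ c → comp c (suc n)) (+-identityʳ x) ⟩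
    comp x (suc n) ∎

  module _ (p k : ℕ) where
    open Pivot (suc p) (suc k)

    bbSum : ℕ → ℕ → ℕ
    bbSum m j = ΣE 0 m (λ l → multichoose (suc m ∸ l) (suc j) * bb m (suc l))

    weigh-bbSum : ∀ m → weigh (bbSum m) p (suc k) ≡ U 0 m
    -- For m₁ = 1 the sum over l is empty; its value 1 is the binomial of `U-base` at `c = 0`, where
    -- all `j + 1` entries precede the bypass of μ.
    weigh-bbSum zero    = trans (weigh-cong (λ j → sym (nCn≡1 (suc j))) p (suc k))
                                (sym (U-base p (suc k) 0))
    weigh-bbSum (suc r) = sym (begin
      U 0 (suc r)
        ≡⟨ U-conv (suc p) (suc k) 0 r ⟩
      Σ< (suc r) (λ i → maxAt i 0 (suc r) * U (suc r ∸ i) 0)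
        ≡⟨ Σ<-cong (suc r) (λ i → trans (cong (maxAt i 0 (suc r) *_) (U-base p (suc k) (suc r ∸ i)))
             (sym (weigh-* (maxAt i 0 (suc r)) (λ j → (suc (suc r ∸ i) + j) C suc j) p (suc k)))) ⟩
      Σ< (suc r) (λ i → weigh (λ j → F i j) p (suc k))
        ≡⟨ weigh-Σ (suc r) F p (suc k) ⟩
      weigh (λ j → Σ< (suc r) (λ i → F i j)) p (suc k)
        ≡⟨ weigh-cong (λ j → trans (Σ<-cong< (suc r) (term j)) (sym (ΣE-0 r (G j)))) p (suc k) ⟩
      weigh (bbSum (suc r)) p (suc k) ∎)
      where
      F : ℕ → ℕ → ℕ
      F i j = maxAt i 0 (suc r) * ((suc (suc r ∸ i) + j) C suc j)

      G : ℕ → ℕ → ℕ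
      G j l = multichoose (suc (suc r) ∸ l) (suc j) * bb (suc r) (suc l)

      term : ∀ j i → i < suc r → F i j ≡ G j i
      term j i i<n = begin
        maxAt i 0 (suc r) * ((suc (suc r ∸ i) + j) C suc j)
          ≡⟨ *-comm (maxAt i 0 (suc r)) _ ⟩
        ((suc (suc r ∸ i) + j) C suc j) * maxAt i 0 (suc r)
          ≡⟨ cong₂ _*_ (cong (λ x → (x ∸ 1) C suc j) (trans (sym (+-suc (suc (suc r ∸ i)) j))
               (cong (_+ suc j) (sym (+-∸-assoc 1 (<⇒≤ i<n)))))) (sym (bb≡maxAt (suc r) i i<n)) ⟩
        multichoose (suc (suc r) ∸ i) (suc j) * bb (suc r) (suc i) ∎

    -- The sums collapse from the inside: the one over k is `comp` by `ΣE-gg`, the one over j is a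
    -- `binomialSum`, the one over i is `weigh`, and `U-conv` accounts for the one over l.
    rhs≡U : ∀ m → rhs (suc m) p (suc k) ≡ U 0 m
    rhs≡U m = begin
      rhs (suc m) p (suc k)
        ≡⟨ ΣE-1 k _ ⟩
      Σ< (suc k) (λ i → ΣE 0 (suc i) (H i))
        ≡⟨ Σ<-cong< (suc k) (λ i i<n → trans (ΣE-0 i (H i)) (trans
             (Σ<-cong (suc i) (term i (s≤s⁻¹ i<n))) (binomialSum-explicit (bbSum m) (λ x → comp x (k ∸ i)) p i))) ⟩
      Σ< (suc k) (λ i → binomialSum (bbSum m) (λ x → comp x (k ∸ i)) p i)
        ≡⟨ weigh-explicit (bbSum m) p (suc k) ⟩
      weigh (bbSum m) p (suc k)
        ≡⟨ weigh-bbSum m ⟩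
      U 0 m ∎
      where
      H : ℕ → ℕ → ℕ
      H i j = (i C j) * bbSum m j *
        ΣE 2 (k + 2 ∸ i) (λ l → gg (k ∸ i) l * multichoose l (p + suc i ∸ j ∸ 1))

      term : ∀ i → i ≤ k → ∀ j → H i j ≡ (i C j) * bbSum m j * comp (p + i ∸ j) (k ∸ i)
      term i i≤k j = cong ((i C j) * bbSum m j *_) (begin
        ΣE 2 (k + 2 ∸ i) (λ l → gg (k ∸ i) l * multichoose l (p + suc i ∸ j ∸ 1))
          ≡⟨ cong₂ (λ u x → ΣE 2 u (λ l → gg (k ∸ i) l * multichoose l x))
               (+-∸-comm 2 i≤k) index ⟩
        ΣE 2 (k ∸ i + 2) (λ l → gg (k ∸ i) l * multichoose l (p + i ∸ j))
          ≡⟨ ΣE-gg (k ∸ i) (p + i ∸ j) ⟩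
        comp (p + i ∸ j) (k ∸ i) ∎)
        where
        index : p + suc i ∸ j ∸ 1 ≡ p + i ∸ j
        index = begin
          p + suc i ∸ j ∸ 1     ≡⟨ cong (λ x → x ∸ j ∸ 1) (+-suc p i) ⟩
          suc (p + i) ∸ j ∸ 1   ≡⟨ ∸-+-assoc (suc (p + i)) j 1 ⟩
          suc (p + i) ∸ (j + 1) ≡⟨ cong (suc (p + i) ∸_) (+-comm j 1) ⟩
          p + i ∸ j             ∎

-- Enumeration of the runs

AllPairs-++⁻ : ∀ (xs : List A) {ys} → AllPairs R (xs ++ ys) →
               AllPairs R xs × AllPairs R ys × All (λ x → All (R x) ys) xs
AllPairs-++⁻ []       Rys         = [] , Rys , []
AllPairs-++⁻ (x ∷ xs) (Rx ∷ Rxys) with AllPairs-++⁻ xs Rxys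
... | Rxs , Rys , Rxsys = All.++⁻ˡ xs Rx ∷ Rxs , Rys , All.++⁻ʳ xs Rx ∷ Rxsys

AllPairs-delete : ∀ (xs : List A) {y ys} → AllPairs R (xs ++ y ∷ ys) → AllPairs R (xs ++ ys)
AllPairs-delete xs Rall with AllPairs-++⁻ xs Rall
... | Rxs , _ ∷ Rys , Rxsys = AllPairs.++⁺ Rxs Rys (All.map All.tail Rxsys)

AllPairs-before : ∀ (xs : List A) {y ys} → AllPairs R (xs ++ y ∷ ys) → All (λ x → R x y) xs
AllPairs-before xs Rall with AllPairs-++⁻ xs Rall
... | _ , _ , Rxsys = All.map All.head Rxsys

AllPairs-after : ∀ (xs : List A) {y ys} → AllPairs R (xs ++ y ∷ ys) → All (R y) ys
AllPairs-after xs Rall with AllPairs-++⁻ xs Rall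
... | _ , Ry ∷ _ , _ = Ry

count-++ : ∀ {A : Set} (p : A → Bool) xs ys → count p (xs ++ ys) ≡ count p xs + count p ys
count-++ p []       ys = refl
count-++ p (x ∷ xs) ys with p x
... | true  = cong suc (count-++ p xs ys)
... | false = count-++ p xs ys

count-map : ∀ {A B : Set} (p : B → Bool) (f : A → B) xs → count p (map f xs) ≡ count (p ∘ f) xs
count-map p f []       = refl
count-map p f (x ∷ xs) with p (f x)
... | true  = cong suc (count-map p f xs)
... | false = count-map p f xs

count-cong : ∀ {A : Set} {p r : A → Bool} xs → (∀ {x} → x ∈ xs → p x ≡ r x) → count p xs ≡ count r xs
count-cong []       p≗r = refl
count-cong {p = p} {r} (x ∷ xs) p≗r with p x | r x | p≗r (here refl)
... | true  | .true  | refl = cong suc (count-cong xs (p≗r ∘ there))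
... | false | .false | refl = count-cong xs (p≗r ∘ there)

count-true : ∀ {A : Set} (xs : List A) → count (λ _ → true) xs ≡ length xs
count-true []       = refl
count-true (x ∷ xs) = cong suc (count-true xs)

count-false : ∀ {A : Set} (xs : List A) → count (λ _ → false) xs ≡ 0
count-false []       = refl
count-false (x ∷ xs) = count-false xs

length-∷ʳ : ∀ (xs : List A) x → length (xs ∷ʳ x) ≡ suc (length xs)
length-∷ʳ xs x = trans (length-++ xs) (+-comm (length xs) 1)

-- Inputs leading to the output bs ++ ys (queued letters left out): the letters of bs
-- are pending, those of ys remain, and E tells which of them can enter the queue.
module Runs (E : ℕ → Bool) where

  mutual
    runs : List ℕ → List ℕ → List (List ℕ)
    runs []       []       = [] ∷ []
    runs []       (y ∷ ys) = picks [] (y ∷ ys)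
    runs (b ∷ bs) ys       = map (b ∷_) (runs bs ys) ++ picks (b ∷ bs) ys

    picks : List ℕ → List ℕ → List (List ℕ)
    picks bs []       = []
    picks bs (y ∷ ys) = (if E y then map (y ∷_) (runs bs ys) else []) ++ picks (bs ∷ʳ y) ys

  -- Inductive form of membership in `runs` and `picks`, on which arguments about a single run
  -- recurse.
  mutual
    data Run : List ℕ → List ℕ → List ℕ → Set where
      done    : Run [] [] []
      bypass  : ∀ {b bs ys w} → Run bs ys w → Run (b ∷ bs) ys (b ∷ w)
      enqueue : ∀ {bs ys w} → Pick bs ys w → Run bs ys w

    data Pick : List ℕ → List ℕ → List ℕ → Set where
      pick : ∀ {bs y ys w} → E y ≡ true → Run bs ys w → Pick bs (y ∷ ys) (y ∷ w)
      skip : ∀ {bs y ys w} → Pick (bs ∷ʳ y) ys w → Pick bs (y ∷ ys) w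

  mutual
    ∈-runs⁻ : ∀ bs ys {w} → w ∈ runs bs ys → Run bs ys w
    ∈-runs⁻ []       []       (here refl) = done
    ∈-runs⁻ []       (y ∷ ys) w∈ = enqueue (∈-picks⁻ [] (y ∷ ys) w∈)
    ∈-runs⁻ (b ∷ bs) ys       w∈ with ∈-++⁻ (map (b ∷_) (runs bs ys)) w∈
    ... | inj₂ w∈₂ = enqueue (∈-picks⁻ (b ∷ bs) ys w∈₂)
    ... | inj₁ w∈₁ with ∈-map⁻ (b ∷_) w∈₁
    ... | w , w∈₁′ , refl = bypass (∈-runs⁻ bs ys w∈₁′)

    ∈-picks⁻ : ∀ bs ys {w} → w ∈ picks bs ys → Pick bs ys w
    ∈-picks⁻ bs (y ∷ ys) w∈ with E y in Ey
    ... | false = skip (∈-picks⁻ (bs ∷ʳ y) ys w∈)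
    ... | true with ∈-++⁻ (map (y ∷_) (runs bs ys)) w∈
    ... | inj₂ w∈₂ = skip (∈-picks⁻ (bs ∷ʳ y) ys w∈₂)
    ... | inj₁ w∈₁ with ∈-map⁻ (y ∷_) w∈₁
    ... | w , w∈₁′ , refl = pick Ey (∈-runs⁻ bs ys w∈₁′)

  mutual
    ∈-runs⁺ : ∀ {bs ys w} → Run bs ys w → w ∈ runs bs ys
    ∈-runs⁺ done = here refl
    ∈-runs⁺ (bypass r) = ∈-++⁺ˡ (∈-map⁺ _ (∈-runs⁺ r))
    ∈-runs⁺ {[]}     {y ∷ ys} (enqueue r) = ∈-picks⁺ r
    ∈-runs⁺ {b ∷ bs} {ys}     (enqueue r) = ∈-++⁺ʳ (map (b ∷_) (runs bs ys)) (∈-picks⁺ r)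

    ∈-picks⁺ : ∀ {bs ys w} → Pick bs ys w → w ∈ picks bs ys
    ∈-picks⁺ {bs} {y ∷ ys} (pick Ey r) rewrite Ey = ∈-++⁺ˡ (∈-map⁺ _ (∈-runs⁺ r))
    ∈-picks⁺ {bs} {y ∷ ys} (skip r) = ∈-++⁺ʳ (if E y then map (y ∷_) (runs bs ys) else []) (∈-picks⁺ r)

  pick-head : ∀ {bs ys x w} → Pick bs ys (x ∷ w) → x ∈ ys
  pick-head (pick _ _) = here refl
  pick-head (skip r)   = there (pick-head r)

  -- The first letter tells the branches apart: a bypass begins with the first pending letter, a
  -- pick with the remaining letter chosen, and the letters are distinct.
  mutual
    runs-unique : ∀ bs ys → Unique (bs ++ ys) → Unique (runs bs ys)
    runs-unique []       []       _ = [] ∷ []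
    runs-unique []       (y ∷ ys) u = picks-unique [] (y ∷ ys) u
    runs-unique (b ∷ bs) ys       (b∉ ∷ u) =
      Unique.++⁺ (Unique.map⁺ ∷-injectiveʳ (runs-unique bs ys u)) (picks-unique (b ∷ bs) ys (b∉ ∷ u)) disjoint
      where
      disjoint : Disjoint (map (b ∷_) (runs bs ys)) (picks (b ∷ bs) ys)
      disjoint (w∈₁ , w∈₂) with ∈-map⁻ (b ∷_) w∈₁
      ... | w , _ , refl =
        All.lookup (All.++⁻ʳ bs b∉) (pick-head (∈-picks⁻ (b ∷ bs) ys w∈₂)) refl

    picks-unique : ∀ bs ys → Unique (bs ++ ys) → Unique (picks bs ys)
    picks-unique bs []       u = []
    picks-unique bs (y ∷ ys) u with E y
    ... | false = picks-unique (bs ∷ʳ y) ys (subst Unique (sym (∷ʳ-++ bs y ys)) u)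
    ... | true  =
      Unique.++⁺ (Unique.map⁺ ∷-injectiveʳ (runs-unique bs ys (AllPairs-delete bs u)))
                 (picks-unique (bs ∷ʳ y) ys (subst Unique (sym (∷ʳ-++ bs y ys)) u)) disjoint
      where
      disjoint : Disjoint (map (y ∷_) (runs bs ys)) (picks (bs ∷ʳ y) ys)
      disjoint (w∈₁ , w∈₂) with ∈-map⁻ (y ∷_) w∈₁
      ... | w , _ , refl = All.lookup (AllPairs-after bs u) (pick-head (∈-picks⁻ (bs ∷ʳ y) ys w∈₂)) refl

  mutual
    length-runs : ∀ bs {ys} → All (λ y → E y ≡ true) ys → length (runs bs ys) ≡ comp (length bs) (length ys)
    length-runs []       []        = refl
    length-runs []       (e ∷ es)  = length-picks [] (e ∷ es)
    length-runs (b ∷ bs) {ys} es   = trans (length-++ (map (b ∷_) (runs bs ys)))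
      (cong₂ _+_ (trans (length-map (b ∷_) (runs bs ys)) (length-runs bs es)) (length-picks (b ∷ bs) es))

    length-picks : ∀ bs {ys} → All (λ y → E y ≡ true) ys → length (picks bs ys) ≡ comp′ (length bs) (length ys)
    length-picks bs []       = refl
    length-picks bs {y ∷ ys} (e ∷ es) rewrite e = trans (length-++ (map (y ∷_) (runs bs ys)))
      (cong₂ _+_ (trans (length-map (y ∷_) (runs bs ys)) (length-runs bs es))
        (trans (length-picks (bs ∷ʳ y) es) (cong (λ c → comp′ c (length ys)) (length-∷ʳ bs y))))

  -- Serves for the block μ P₁, which becomes pending as a whole.
  picks-skip : ∀ bs {ns} zs → All (λ y → E y ≡ false) ns → picks bs (ns ++ zs) ≡ picks (bs ++ ns) zs
  picks-skip bs zs [] = cong (λ xs → picks xs zs) (sym (Data.List.Properties.++-identityʳ bs))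
  picks-skip bs {n ∷ ns} zs (e ∷ es) rewrite e =
    trans (picks-skip (bs ∷ʳ n) zs es) (cong (λ xs → picks xs zs) (∷ʳ-++ bs n ns))

  module _ {n ns zs} (¬Ens : All (λ y → E y ≡ false) (n ∷ ns)) (Ezs : All (λ y → E y ≡ true) zs) where
    open Pivot (length (n ∷ ns)) (length zs)

    mutual
      length-runs-pivot : ∀ bs {xs} → All (λ y → E y ≡ true) xs →
        length (runs bs (xs ++ n ∷ ns ++ zs)) ≡ U (length bs) (length xs)
      length-runs-pivot []       []       = length-picks-pivot [] []
      length-runs-pivot []       (e ∷ es) = length-picks-pivot [] (e ∷ es)
      length-runs-pivot (b ∷ bs) {xs} es  = trans (length-++ (map (b ∷_) (runs bs (xs ++ n ∷ ns ++ zs))))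
        (cong₂ _+_ (trans (length-map (b ∷_) (runs bs _)) (length-runs-pivot bs es))
                   (length-picks-pivot (b ∷ bs) es))

      length-picks-pivot : ∀ bs {xs} → All (λ y → E y ≡ true) xs →
        length (picks bs (xs ++ n ∷ ns ++ zs)) ≡ U′ (length bs) (length xs)
      -- No letter of M₁ before μ remains, so the next letter to enter belongs to M₂, where every
      -- letter is eligible.
      length-picks-pivot bs []       = trans (cong length (picks-skip bs zs ¬Ens))
        (trans (length-picks (bs ++ n ∷ ns) Ezs) (cong (λ c → comp′ c (length zs)) (length-++ bs)))
      length-picks-pivot bs {x ∷ xs} (e ∷ es) rewrite e =
        trans (length-++ (map (x ∷_) (runs bs (xs ++ n ∷ ns ++ zs))))
          (cong₂ _+_ (trans (length-map (x ∷_) (runs bs _)) (length-runs-pivot bs es))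
            (trans (length-picks-pivot (bs ∷ʳ x) es) (cong (λ c → U′ c (length xs)) (length-∷ʳ bs x))))

-- Free runs by the position of the largest letter and by the first drop

allEligible : ℕ → Bool
allEligible _ = true

open Runs allEligible using () renaming (runs to freeRuns; picks to freePicks)

length-freeRuns : ∀ bs ys → length (freeRuns bs ys) ≡ comp (length bs) (length ys)
length-freeRuns bs ys = Runs.length-runs allEligible bs (All.universal (λ _ → refl) ys)

≡ᵇ-refl : ∀ n → (n ≡ᵇ n) ≡ true
≡ᵇ-refl zero    = refl
≡ᵇ-refl (suc n) = ≡ᵇ-refl n

≢⇒≡ᵇ-false : ∀ {m n} → m ≢ n → (m ≡ᵇ n) ≡ false
≢⇒≡ᵇ-false {zero}  {zero}  m≢n = contradiction refl m≢n
≢⇒≡ᵇ-false {zero}  {suc n} m≢n = refl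
≢⇒≡ᵇ-false {suc m} {zero}  m≢n = refl
≢⇒≡ᵇ-false {suc m} {suc n} m≢n = ≢⇒≡ᵇ-false (m≢n ∘ cong suc)

<⇒<ᵇ-true : ∀ {m n} → m < n → (m <ᵇ n) ≡ true
<⇒<ᵇ-true {zero}  {suc n} _         = refl
<⇒<ᵇ-true {suc m} {suc n} (s≤s m<n) = <⇒<ᵇ-true m<n

≤⇒<ᵇ-false : ∀ {m n} → n ≤ m → (m <ᵇ n) ≡ false
≤⇒<ᵇ-false {m}     {zero}  _         = refl
≤⇒<ᵇ-false {suc m} {suc n} (s≤s n≤m) = ≤⇒<ᵇ-false n≤m

count-≡false : ∀ {A : Set} {p : A → Bool} xs → (∀ x → p x ≡ false) → count p xs ≡ 0
count-≡false xs p≗f = trans (count-cong xs λ {x} _ → p≗f x) (count-false xs)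

count-≡true : ∀ {A : Set} {p : A → Bool} xs → (∀ x → p x ≡ true) → count p xs ≡ length xs
count-≡true xs p≗t = trans (count-cong xs λ {x} _ → p≗t x) (count-true xs)

count-branch : ∀ (p : List ℕ → Bool) x xss yss →
               count p (map (x ∷_) xss ++ yss) ≡ count (p ∘ (x ∷_)) xss + count p yss
count-branch p x xss yss = trans (count-++ p (map (x ∷_) xss) yss) (cong (_+ count p yss) (count-map p (x ∷_) xss))

module _ {n : ℕ} (0<n : 0 < n) where

  maxIs : ℕ → List ℕ → Bool
  maxIs i w = at w (suc i) ≡ᵇ n

  -- Positivity of `n` handles positions beyond the end, where `at` takes the default value 0.
  at≢ : ∀ i {bs} → All (_≢ n) bs → at bs (suc i) ≢ n
  at≢ i       []         = <⇒≢ 0<n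
  at≢ zero    (b≢n ∷ _)  = b≢n
  at≢ (suc i) (_ ∷ bs≢n) = at≢ i bs≢n

  runs-[] : ∀ bs → freeRuns bs [] ≡ bs ∷ []
  runs-[] []       = refl
  runs-[] (b ∷ bs) rewrite runs-[] bs = refl

  count-maxIs-[] : ∀ i {bs} → All (_≢ n) bs → count (maxIs i) (freeRuns bs []) ≡ 0
  count-maxIs-[] i {bs} bs≢n rewrite runs-[] bs | ≢⇒≡ᵇ-false (at≢ i bs≢n) = refl

  mutual
    count-maxIs : ∀ i {bs ys} → All (_≢ n) bs → All (_≢ n) ys →
      count (maxIs i) (freeRuns bs (ys ∷ʳ n)) ≡ maxAt i (length bs) (suc (length ys))
    count-maxIs zero    {[]}     {[]}     bs≢n ys≢n = count-maxIs-picks₀ bs≢n ys≢n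
    count-maxIs zero    {[]}     {y ∷ ys} bs≢n ys≢n = count-maxIs-picks₀ bs≢n ys≢n
    count-maxIs (suc i) {[]}     {[]}     bs≢n ys≢n = count-maxIs-picks i bs≢n ys≢n
    count-maxIs (suc i) {[]}     {y ∷ ys} bs≢n ys≢n = count-maxIs-picks i bs≢n ys≢n
    count-maxIs zero    {b ∷ bs} {ys}     bs≢n@(b≢n ∷ _) ys≢n =
      trans (count-branch (maxIs 0) b (freeRuns bs (ys ∷ʳ n)) _)
        (cong₂ _+_ (count-≡false (freeRuns bs (ys ∷ʳ n)) λ _ → ≢⇒≡ᵇ-false b≢n) (count-maxIs-picks₀ bs≢n ys≢n))
    count-maxIs (suc i) {b ∷ bs} {ys}     bs≢n@(_ ∷ bs≢n′) ys≢n =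
      trans (count-branch (maxIs (suc i)) b (freeRuns bs (ys ∷ʳ n)) _)
        (cong₂ _+_ (count-maxIs i bs≢n′ ys≢n) (count-maxIs-picks i bs≢n ys≢n))

    count-maxIs-picks₀ : ∀ {bs ys} → All (_≢ n) bs → All (_≢ n) ys →
      count (maxIs 0) (freePicks bs (ys ∷ʳ n)) ≡ 1
    count-maxIs-picks₀ {bs} {[]}     bs≢n _ =
      trans (count-branch (maxIs 0) n (freeRuns bs []) _)
        (cong (_+ 0) (trans (count-≡true (freeRuns bs []) λ _ → ≡ᵇ-refl n) (cong length (runs-[] bs))))
    count-maxIs-picks₀ {bs} {y ∷ ys} bs≢n (y≢n ∷ ys≢n) =
      trans (count-branch (maxIs 0) y (freeRuns bs (ys ∷ʳ n)) _)
        (cong₂ _+_ (count-≡false (freeRuns bs (ys ∷ʳ n)) λ _ → ≢⇒≡ᵇ-false y≢n)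
          (count-maxIs-picks₀ (All.∷ʳ⁺ bs≢n y≢n) ys≢n))

    count-maxIs-picks : ∀ i {bs ys} → All (_≢ n) bs → All (_≢ n) ys →
      count (maxIs (suc i)) (freePicks bs (ys ∷ʳ n)) ≡ skips (maxAt i) (length bs) (suc (length ys))
    count-maxIs-picks i {bs} {[]}     bs≢n _ =
      trans (count-branch (maxIs (suc i)) n (freeRuns bs []) _)
        (cong (_+ 0) (trans (count-maxIs-[] i bs≢n) (sym (maxAt-zero i (length bs)))))
    count-maxIs-picks i {bs} {y ∷ ys} bs≢n (y≢n ∷ ys≢n) =
      trans (count-branch (maxIs (suc i)) y (freeRuns bs (ys ∷ʳ n)) _)
        (cong₂ _+_ (count-maxIs i bs≢n ys≢n)
          (trans (count-maxIs-picks i (All.∷ʳ⁺ bs≢n y≢n) ys≢n)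
            (cong (λ c → skips (maxAt i) c (suc (length ys))) (length-∷ʳ bs y))))

-- The end of the word counts as a drop, in accordance with g_{n,n+1} = 1.
firstDrop : ℕ → List ℕ → ℕ → Bool
firstDrop m []      zero    = true
firstDrop m []      (suc k) = false
firstDrop m (x ∷ w) zero    = not (m <ᵇ x)
firstDrop m (x ∷ w) (suc k) = (m <ᵇ x) ∧ firstDrop x w k

-- Pending letters are at most `m`, the last letter read, and remaining ones exceed it. Hence a
-- bypass is a drop and an entry is a rise, and the first drop occurs at the first bypass.
mutual
  count-firstDrop : ∀ k {m} bs ys → AllPairs _<_ (bs ++ ys) → All (_≤ m) bs → All (m <_) ys →
    count (λ w → firstDrop m w k) (freeRuns bs ys) ≡ dropAt k (length bs) (length ys)
  count-firstDrop zero    []       []       _ _ _ = refl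
  count-firstDrop (suc k) []       []       _ _ _ = refl
  count-firstDrop zero    []       (y ∷ ys) s _ m<ys = count-firstDrop-picks₀ [] m<ys
  count-firstDrop (suc k) []       (y ∷ ys) s _ m<ys = count-firstDrop-picks k [] (y ∷ ys) s m<ys
  count-firstDrop zero    {m} (b ∷ bs) ys   s (b≤m ∷ _) m<ys =
    trans (count-branch (λ w → firstDrop m w 0) b (freeRuns bs ys) _)
      (trans (cong₂ _+_ (trans (count-≡true (freeRuns bs ys) λ _ → cong not (≤⇒<ᵇ-false b≤m)) (length-freeRuns bs ys))
                        (count-firstDrop-picks₀ (b ∷ bs) m<ys))
        (+-identityʳ _))
  count-firstDrop (suc k) {m} (b ∷ bs) ys   s (b≤m ∷ _) m<ys =
    trans (count-branch (λ w → firstDrop m w (suc k)) b (freeRuns bs ys) _)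
      (cong₂ _+_ (count-≡false (freeRuns bs ys) λ w → cong (_∧ firstDrop b w k) (≤⇒<ᵇ-false b≤m))
                 (count-firstDrop-picks k (b ∷ bs) ys s m<ys))

  count-firstDrop-picks₀ : ∀ {m} bs {ys} → All (m <_) ys →
    count (λ w → firstDrop m w 0) (freePicks bs ys) ≡ 0
  count-firstDrop-picks₀ bs []            = refl
  count-firstDrop-picks₀ {m} bs {y ∷ ys} (m<y ∷ m<ys) =
    trans (count-branch (λ w → firstDrop m w 0) y (freeRuns bs ys) _)
      (cong₂ _+_ (count-≡false (freeRuns bs ys) λ _ → cong not (<⇒<ᵇ-true m<y))
                 (count-firstDrop-picks₀ (bs ∷ʳ y) m<ys))

  count-firstDrop-picks : ∀ k {m} bs ys → AllPairs _<_ (bs ++ ys) → All (m <_) ys →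
    count (λ w → firstDrop m w (suc k)) (freePicks bs ys) ≡ skips (dropAt k) (length bs) (length ys)
  count-firstDrop-picks k bs []       s _ = refl
  count-firstDrop-picks k {m} bs (y ∷ ys) s (m<y ∷ m<ys) =
    trans (count-branch (λ w → firstDrop m w (suc k)) y (freeRuns bs ys) _)
      (cong₂ _+_
        (trans (count-cong (freeRuns bs ys) λ {w} _ → cong (_∧ firstDrop y w k) (<⇒<ᵇ-true m<y))
          (count-firstDrop k bs ys (AllPairs-delete bs s) (All.map <⇒≤ (AllPairs-before bs s)) (AllPairs-after bs s)))
        (trans (count-firstDrop-picks k (bs ∷ʳ y) ys (subst (AllPairs _<_) (sym (∷ʳ-++ bs y ys)) s) m<ys)
          (cong (λ c → skips (dropAt k) c (length ys)) (length-∷ʳ bs y))))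

-- Queuesort as a recursive scan

-- m stands for the maximum of the letters already read.
scan : ℕ → List ℕ → List ℕ
scan m []      = []
scan m (x ∷ w) = if m <ᵇ x then slide x (scan x w) else x ∷ scan m w

-- Positions i are counted from 0.
ltr : ℕ → List ℕ → ℕ → Bool
ltr m w i = (m <ᵇ at w (suc i)) ∧ isLTRmax w (suc i)

all-applyUpTo-cong : ∀ {p r : ℕ → Bool} (f g : ℕ → ℕ) n → (∀ i → i < n → p (f i) ≡ r (g i)) →
                     all p (applyUpTo f n) ≡ all r (applyUpTo g n)
all-applyUpTo-cong f g zero    p≗r = refl
all-applyUpTo-cong f g (suc n) p≗r =
  cong₂ _∧_ (p≗r 0 z<s) (all-applyUpTo-cong (f ∘ suc) (g ∘ suc) n λ i i<n → p≗r (suc i) (s<s i<n))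

isLTRmax-∷ : ∀ x w i → isLTRmax (x ∷ w) (suc (suc i)) ≡ (x <ᵇ at w (suc i)) ∧ isLTRmax w (suc i)
isLTRmax-∷ x w i = cong ((x <ᵇ at w (suc i)) ∧_) (all-applyUpTo-cong _ _ i λ _ _ → refl)

<ᵇ-false-mono : ∀ {m x} y → m ≤ x → (m <ᵇ y) ≡ false → (x <ᵇ y) ≡ false
<ᵇ-false-mono {m} y m≤x m≮y with m <? y
... | yes m<y = contradiction (trans (sym m≮y) (<⇒<ᵇ-true m<y)) λ ()
... | no m≮y′ = ≤⇒<ᵇ-false (≤-trans (≮⇒≥ m≮y′) m≤x)

<ᵇ-∧ : ∀ {m x} y b → m ≤ x → (m <ᵇ y) ∧ (x <ᵇ y) ∧ b ≡ (x <ᵇ y) ∧ b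
<ᵇ-∧ {m} {x} y b m≤x with m <ᵇ y in eq
... | true  = refl
... | false = cong (_∧ b) (sym (<ᵇ-false-mono y m≤x eq))

<ᵇ-∧′ : ∀ {m x} y b → x ≤ m → (m <ᵇ y) ∧ (x <ᵇ y) ∧ b ≡ (m <ᵇ y) ∧ b
<ᵇ-∧′ {m} {x} y b x≤m with x <ᵇ y in eq
... | true  = refl
... | false = trans (∧-zeroʳ (m <ᵇ y)) (cong (_∧ b) (sym (<ᵇ-false-mono y x≤m eq)))

ltr-zero : ∀ m x w → ltr m (x ∷ w) 0 ≡ (m <ᵇ x)
ltr-zero m x w = ∧-identityʳ (m <ᵇ x)

ltr-above : ∀ {m x} w i → m ≤ x → ltr m (x ∷ w) (suc i) ≡ ltr x w i
ltr-above {m} {x} w i m≤x = trans (cong ((m <ᵇ at w (suc i)) ∧_) (isLTRmax-∷ x w i))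
  (<ᵇ-∧ (at w (suc i)) (isLTRmax w (suc i)) m≤x)

ltr-below : ∀ {m x} w i → x ≤ m → ltr m (x ∷ w) (suc i) ≡ ltr m w i
ltr-below {m} {x} w i x≤m = trans (cong ((m <ᵇ at w (suc i)) ∧_) (isLTRmax-∷ x w i))
  (<ᵇ-∧′ (at w (suc i)) (isLTRmax w (suc i)) x≤m)

All-at : ∀ {P : ℕ → Set} {w i} → All P w → i < length w → P (at w (suc i))
All-at {i = zero}  (p ∷ ps) _         = p
All-at {i = suc i} (p ∷ ps) (s<s i<n) = All-at ps i<n

isLTRmax≡ltr : ∀ {w i} → All (0 <_) w → i < length w → isLTRmax w (suc i) ≡ ltr 0 w i
isLTRmax≡ltr {w} {i} w>0 i<n = cong (_∧ isLTRmax w (suc i)) (sym (<⇒<ᵇ-true (All-at w>0 i<n)))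

all-at⇒All : ∀ {P : ℕ → Set} w → (∀ i → i < length w → P (at w (suc i))) → All P w
all-at⇒All []      Pw = []
all-at⇒All (x ∷ w) Pw = Pw 0 z<s ∷ all-at⇒All w λ i i<n → Pw (suc i) (s<s i<n)

firstDrop-ltr : ∀ m w k → k < length w →
  not (ltr m w k) ∧ all (ltr m w) (applyUpTo id k) ≡ firstDrop m w k
firstDrop-ltr m (x ∷ w) zero    _ = trans (∧-identityʳ (not (ltr m (x ∷ w) 0))) (cong not (ltr-zero m x w))
firstDrop-ltr m (x ∷ w) (suc k) (s<s k<n) with m <? x
... | yes m<x rewrite <⇒<ᵇ-true m<x | ltr-above w k (<⇒≤ m<x) =
  trans (cong (not (ltr x w k) ∧_) (all-applyUpTo-cong suc id k λ i _ → ltr-above w i (<⇒≤ m<x)))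
        (firstDrop-ltr x w k k<n)
... | no m≮x rewrite ≤⇒<ᵇ-false (≮⇒≥ m≮x) = ∧-zeroʳ _

firstDrop-isLTRmax : ∀ {w} k → All (0 <_) w → k < length w →
  not (isLTRmax w (suc k)) ∧ all (isLTRmax w) (range 1 k) ≡ firstDrop 0 w k
firstDrop-isLTRmax {w} k w>0 k<n = trans
  (cong₂ _∧_ (cong not (isLTRmax≡ltr w>0 k<n))
    (all-applyUpTo-cong suc id k λ i i<k → isLTRmax≡ltr w>0 (<-trans i<k k<n)))
  (firstDrop-ltr 0 w k k<n)

ltrs : ℕ → List ℕ → List ℕ
ltrs m []      = []
ltrs m (x ∷ w) = if m <ᵇ x then x ∷ ltrs x w else ltrs m w

map-filter-applyUpTo : ∀ (f f′ : ℕ → ℕ) (p p′ : ℕ → Bool) (g g′ : ℕ → ℕ) n →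
  (∀ i → i < n → f (g i) ≡ f′ (g′ i)) → (∀ i → i < n → p (g i) ≡ p′ (g′ i)) →
  map f (filterᵇ p (applyUpTo g n)) ≡ map f′ (filterᵇ p′ (applyUpTo g′ n))
map-filter-applyUpTo f f′ p p′ g g′ zero    f≗ p≗ = refl
map-filter-applyUpTo f f′ p p′ g g′ (suc n) f≗ p≗
  with p (g 0) | p′ (g′ 0) | p≗ 0 z<s
     | map-filter-applyUpTo f f′ p p′ (g ∘ suc) (g′ ∘ suc) n (λ i i<n → f≗ (suc i) (s<s i<n)) (λ i i<n → p≗ (suc i) (s<s i<n))
... | true  | .true  | refl | rec = cong₂ _∷_ (f≗ 0 z<s) rec
... | false | .false | refl | rec = rec

ltrs-at : ∀ m w → map (λ i → at w (suc i)) (filterᵇ (ltr m w) (applyUpTo id (length w))) ≡ ltrs m w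
ltrs-at m []      = refl
ltrs-at m (x ∷ w) rewrite ltr-zero m x w with m <? x
... | yes m<x rewrite <⇒<ᵇ-true m<x = cong (x ∷_) (trans
  (map-filter-applyUpTo _ (λ i → at w (suc i)) _ (ltr x w) suc id (length w)
    (λ _ _ → refl) (λ i _ → ltr-above w i (<⇒≤ m<x)))
  (ltrs-at x w))
... | no m≮x rewrite ≤⇒<ᵇ-false (≮⇒≥ m≮x) = trans
  (map-filter-applyUpTo _ (λ i → at w (suc i)) _ (ltr m w) suc id (length w)
    (λ _ _ → refl) (λ i _ → ltr-below w i (≮⇒≥ m≮x)))
  (ltrs-at m w)

ltrMaxima≡ltrs : ∀ {w} → All (0 <_) w → ltrMaxima w ≡ ltrs 0 w
ltrMaxima≡ltrs {w} w>0 = trans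
  (map-filter-applyUpTo (at w) (λ i → at w (suc i)) (isLTRmax w) (ltr 0 w) suc id (length w)
    (λ _ _ → refl) (λ i → isLTRmax≡ltr w>0))
  (ltrs-at 0 w)

ltrs-above : ∀ m w → All (m <_) (ltrs m w)
ltrs-above m []      = []
ltrs-above m (x ∷ w) with m <? x
... | yes m<x rewrite <⇒<ᵇ-true m<x = m<x ∷ All.map (<-trans m<x) (ltrs-above x w)
... | no m≮x rewrite ≤⇒<ᵇ-false (≮⇒≥ m≮x) = ltrs-above m w

-- `push v` looks for the letter `v` itself, so it walks past a smaller first letter without moving
-- it.
push-∷ : ∀ {x} w {vs} → All (x <_) vs → foldr push (x ∷ w) vs ≡ x ∷ foldr push w vs
push-∷ w [] = refl
push-∷ w {v ∷ vs} (x<v ∷ x<vs) rewrite push-∷ w x<vs | ≢⇒≡ᵇ-false (<⇒≢ x<v) = refl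

-- The maxima are pushed from right to left. When a maximum `x` at the front gets its turn, the
-- larger ones have already turned the rest into `scan x w`.
push-ltrs : ∀ m w → foldr push w (ltrs m w) ≡ scan m w
push-ltrs m []      = refl
push-ltrs m (x ∷ w) with m <? x
... | yes m<x rewrite <⇒<ᵇ-true m<x | push-∷ w (ltrs-above x w) | ≡ᵇ-refl x = cong (slide x) (push-ltrs x w)
... | no m≮x rewrite ≤⇒<ᵇ-false (≮⇒≥ m≮x) =
  trans (push-∷ w (All.map (≤-<-trans (≮⇒≥ m≮x)) (ltrs-above m w))) (cong (x ∷_) (push-ltrs m w))

q≡scan : ∀ {w} → All (0 <_) w → q w ≡ scan 0 w
q≡scan {w} w>0 = trans (reverse-foldl (flip push) w (ltrMaxima w))
  (trans (cong (foldr push w) (ltrMaxima≡ltrs w>0)) (push-ltrs 0 w))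

-- Runs are preimages: foldr slide (scan m w) Q is the output when the queue holds Q
-- and w remains to be read.

slide-≤head : ∀ {a} zs → Maybe.All (a ≤_) (head zs) → slide a zs ≡ a ∷ zs
slide-≤head []       _          = refl
slide-≤head (z ∷ zs) (just a≤z) rewrite ≤⇒<ᵇ-false a≤z = refl

slide-past : ∀ {b} zs {Q} → All (b <_) Q → foldr slide (b ∷ zs) Q ≡ b ∷ foldr slide zs Q
slide-past zs [] = refl
slide-past zs {a ∷ Q} (b<a ∷ b<Q) rewrite slide-past zs b<Q | <⇒<ᵇ-true b<a = refl

slide-length : ∀ a zs → length (slide a zs) ≡ suc (length zs)
slide-length a []       = refl
slide-length a (z ∷ zs) with z <ᵇ a
... | true  = cong suc (slide-length a zs)
... | false = refl

slides-length : ∀ Q zs → length (foldr slide zs Q) ≡ length Q + length zs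
slides-length []      zs = refl
slides-length (a ∷ Q) zs = trans (slide-length a (foldr slide zs Q)) (cong suc (slides-length Q zs))

slide-∷-injective : ∀ {a} zs {rs} → slide a zs ≡ a ∷ rs → zs ≡ rs
slide-∷-injective []       refl = refl
slide-∷-injective {a} (z ∷ zs) eq with z <? a
... | yes z<a rewrite <⇒<ᵇ-true z<a = contradiction (∷-injectiveˡ eq) (<⇒≢ z<a)
... | no z≮a rewrite ≤⇒<ᵇ-false (≮⇒≥ z≮a) = ∷-injectiveʳ eq

-- Either the letter just read has bypassed the whole queue, or a queued letter leaves first.
-- `slides-bypass⁻` uses this to recognise the letter that bypasses.
slides-head : ∀ x zs Q {y ys} → foldr slide (x ∷ zs) Q ≡ y ∷ ys → y ≤ x × (y ≡ x ⊎ y ∈ Q)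
slides-head x zs []      refl = ≤-refl , inj₁ refl
slides-head x zs (a ∷ Q) eq with foldr slide (x ∷ zs) Q in eq′
... | [] = contradiction (trans (sym (cong length eq′)) (trans (slides-length Q (x ∷ zs)) (+-suc _ _))) λ ()
... | z ∷ zs′ with slides-head x zs Q eq′ | z <? a
... | z≤x , inj₁ refl | yes z<a rewrite <⇒<ᵇ-true z<a with refl ← eq = z≤x , inj₁ refl
... | z≤x , inj₂ z∈Q  | yes z<a rewrite <⇒<ᵇ-true z<a with refl ← eq = z≤x , inj₂ (there z∈Q)
... | z≤x , _ | no z≮a rewrite ≤⇒<ᵇ-false (≮⇒≥ z≮a) with refl ← eq = ≤-trans (≮⇒≥ z≮a) z≤x , inj₂ (here refl)

-- The mark that a passage through the queue leaves in the output; it is the condition that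
-- `Eligible` tests.
record Settled (x : ℕ) (zs : List ℕ) : Set where
  constructor settled
  field
    {before after} : List ℕ
    split   : zs ≡ before ++ x ∷ after
    before< : All (_< x) before
    after≥  : Maybe.All (x ≤_) (head after)

slide-settled : ∀ x zs → Settled x (slide x zs)
slide-settled x []       = settled refl [] nothing
slide-settled x (z ∷ zs) with z <? x
... | no z≮x rewrite ≤⇒<ᵇ-false (≮⇒≥ z≮x) = settled refl [] (just (≮⇒≥ z≮x))
... | yes z<x rewrite <⇒<ᵇ-true z<x with slide-settled x zs
... | settled eq α<x x≤β = settled (cong (z ∷_) eq) (z<x ∷ α<x) x≤β

-- The letter `a` is smaller than `x` and stops in front of it at the latest, so the part from `x`
-- onwards is untouched.
slide-keeps-settled : ∀ {a x} α {β} → a < x → All (_< x) α → Maybe.All (x ≤_) (head β) →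
                      Settled x (slide a (α ++ x ∷ β))
slide-keeps-settled {a} []      a<x []          x≤β rewrite ≤⇒<ᵇ-false (<⇒≤ a<x) =
  settled {before = a ∷ []} refl (a<x ∷ []) x≤β
slide-keeps-settled {a} (y ∷ α) a<x (y<x ∷ α<x) x≤β with y <? a
... | no y≮a rewrite ≤⇒<ᵇ-false (≮⇒≥ y≮a) = settled {before = a ∷ y ∷ α} refl (a<x ∷ y<x ∷ α<x) x≤β
... | yes y<a rewrite <⇒<ᵇ-true y<a with slide-keeps-settled α a<x α<x x≤β
... | settled eq α′<x x≤β′ = settled (cong (y ∷_) eq) (y<x ∷ α′<x) x≤β′

slides-settled : ∀ {x zs Q} → All (_< x) Q → Settled x zs → Settled x (foldr slide zs Q)
slides-settled []          s = s
slides-settled {zs = zs} {a ∷ Q} (a<x ∷ Q<x) s with foldr slide zs Q | slides-settled Q<x s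
... | _ | settled {α} refl α<x x≤β = slide-keeps-settled α a<x α<x x≤β

interleave-∷ʳˡ : ∀ {Q bs τ : List ℕ} x → Interleaving Q bs τ → Interleaving (Q ∷ʳ x) bs (τ ∷ʳ x)
interleave-∷ʳˡ x []         = consˡ []
interleave-∷ʳˡ x (consˡ sp) = consˡ (interleave-∷ʳˡ x sp)
interleave-∷ʳˡ x (consʳ sp) = consʳ (interleave-∷ʳˡ x sp)

interleave-∷ʳʳ : ∀ {Q bs τ : List ℕ} x → Interleaving Q bs τ → Interleaving Q (bs ∷ʳ x) (τ ∷ʳ x)
interleave-∷ʳʳ x []         = consʳ []
interleave-∷ʳʳ x (consˡ sp) = consˡ (interleave-∷ʳʳ x sp)
interleave-∷ʳʳ x (consʳ sp) = consʳ (interleave-∷ʳʳ x sp)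

interleave-++ʳ : ∀ {Q bs τ : List ℕ} xs → Interleaving Q bs τ → Interleaving Q (bs ++ xs) (τ ++ xs)
interleave-++ʳ {bs = bs} {τ} []       sp rewrite ++-identityʳ bs | ++-identityʳ τ = sp
interleave-++ʳ {bs = bs} {τ} (x ∷ xs) sp =
  subst₂ (Interleaving _) (∷ʳ-++ bs x xs) (∷ʳ-++ τ x xs) (interleave-++ʳ xs (interleave-∷ʳʳ x sp))

interleave-Allˡ : ∀ {P : ℕ → Set} {Q bs τ} → Interleaving Q bs τ → All P τ → All P Q
interleave-Allˡ []         []       = []
interleave-Allˡ (consˡ sp) (p ∷ ps) = p ∷ interleave-Allˡ sp ps
interleave-Allˡ (consʳ sp) (p ∷ ps) = interleave-Allˡ sp ps

interleave-Allʳ : ∀ {P : ℕ → Set} {Q bs τ} → Interleaving Q bs τ → All P τ → All P bs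
interleave-Allʳ []         []       = []
interleave-Allʳ (consˡ sp) (p ∷ ps) = interleave-Allʳ sp ps
interleave-Allʳ (consʳ sp) (p ∷ ps) = p ∷ interleave-Allʳ sp ps

++-split-at : ∀ {x : ℕ} τ {ys} α {β} → All (_≢ x) τ → τ ++ ys ≡ α ++ x ∷ β →
              ∃ λ γ → α ≡ τ ++ γ × ys ≡ γ ++ x ∷ β
++-split-at []      α       []           eq = α , refl , eq
++-split-at (t ∷ τ) []      (t≢x ∷ _)    eq = contradiction (∷-injectiveˡ eq) t≢x
++-split-at (t ∷ τ) (s ∷ α) (_ ∷ τ≢x)    eq with ∷-injective eq
... | refl , eq′ with ++-split-at τ α τ≢x eq′
... | γ , α≡ , ys≡ = γ , cong (t ∷_) α≡ , ys≡

Linked-++⁻ʳ : ∀ {R : ℕ → ℕ → Set} xs {ys} → Linked R (xs ++ ys) → Linked R ys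
Linked-++⁻ʳ []       Rys = Rys
Linked-++⁻ʳ (x ∷ xs) Rys = Linked-++⁻ʳ xs (Linked.tail Rys)

module _ (E : ℕ → Bool) where
  open Runs E

  -- Both restrict eligible letters only. They are what makes a letter that entered the queue come
  -- out at its place in the output.
  LeftMax Ascent : List ℕ → Set
  LeftMax = AllPairs (λ x y → E y ≡ true → x < y)
  Ascent  = Linked (λ x y → E x ≡ true → x < y)

  Ascent-head : ∀ {x xs} → E x ≡ true → Ascent (x ∷ xs) → Maybe.All (x ≤_) (head xs)
  Ascent-head Ex [-]     = nothing
  Ascent-head Ex (r ∷ _) = just (<⇒≤ (r Ex))

  slides-increasing : ∀ {Q τ ys} → Interleaving Q [] τ → All (λ a → E a ≡ true) Q → Ascent (τ ++ ys) →
                      foldr slide ys Q ≡ τ ++ ys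
  slides-increasing []         []        asc = refl
  slides-increasing (consˡ sp) (Ea ∷ EQ) asc
    rewrite slides-increasing sp EQ (Linked.tail asc) = slide-≤head _ (Ascent-head Ea asc)

  before-all : ∀ {b zs Q bs τ} → Interleaving Q bs τ → All (λ a → E a ≡ true) Q →
               All (λ y → E y ≡ true → b < y) (τ ++ zs) → All (b <_) Q
  before-all []         []        _        = []
  before-all (consˡ sp) (Ea ∷ EQ) (l ∷ ls) = l Ea ∷ before-all sp EQ ls
  before-all (consʳ sp) EQ        (l ∷ ls) = before-all sp EQ ls

  record Bypassed (b : ℕ) (bs Q τ : List ℕ) : Set where
    constructor bypassed
    field
      {queue target} : List ℕ
      popped : List ℕ
      interl : Interleaving queue bs target
      split  : τ ≡ popped ++ b ∷ target
      elig   : All (λ a → E a ≡ true) queue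

  -- Queued letters ahead of `b` in τ leave before it, since by `Ascent` they do not pass their
  -- successors. Those behind `b` exceed it by `LeftMax`, so `b` bypasses them.
  slides-bypass : ∀ {b bs Q τ ys} → Interleaving Q (b ∷ bs) τ → All (λ a → E a ≡ true) Q →
    LeftMax (τ ++ ys) → Ascent (τ ++ ys) →
    ∃ λ (s : Bypassed b bs Q τ) → ∀ zs →
      foldr slide (b ∷ zs) Q ≡ Bypassed.popped s ++ b ∷ foldr slide zs (Bypassed.queue s)
  slides-bypass (consʳ sp) EQ (lm ∷ _) asc =
    bypassed [] sp refl EQ , λ zs → slide-past zs (before-all sp EQ lm)
  slides-bypass {Q = a ∷ _} (consˡ sp) (Ea ∷ EQ) (_ ∷ lms) asc with slides-bypass sp EQ lms (Linked.tail asc)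
  ... | bypassed [] sp′ refl EQ′ , eq =
    bypassed (a ∷ []) sp′ refl EQ′ ,
    λ zs → trans (cong (slide a) (eq zs)) (slide-≤head _ (Ascent-head Ea asc))
  ... | bypassed (p ∷ ps) sp′ refl EQ′ , eq =
    bypassed (a ∷ p ∷ ps) sp′ refl EQ′ ,
    λ zs → trans (cong (slide a) (eq zs)) (slide-≤head _ (Ascent-head Ea asc))

  -- Induction along the run. The invariant: τ interleaves the queue `Q` with the pending letters in
  -- the order of the output, pending letters are at most `m`, and eligible remaining letters exceed
  -- `m`.
  mutual
    run⇒scan : ∀ {m Q bs τ ys w} → Interleaving Q bs τ → All (λ a → E a ≡ true) Q →
      LeftMax (τ ++ ys) → Ascent (τ ++ ys) → All (_≤ m) bs → All (λ y → E y ≡ true → m < y) ys →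
      Run bs ys w → foldr slide (scan m w) Q ≡ τ ++ ys
    run⇒scan sp EQ lm asc _ _ done = slides-increasing sp EQ asc
    run⇒scan {m} {ys = ys} sp EQ lm asc (b≤m ∷ bs≤m) m<ys (bypass {b} {w = w} r)
      rewrite ≤⇒<ᵇ-false b≤m with slides-bypass sp EQ lm asc
    ... | bypassed {target = τ′} ps sp′ refl EQ′ , eq = trans (eq (scan m w)) (trans
      (cong (λ l → ps ++ b ∷ l)
        (run⇒scan sp′ EQ′ (AllPairs.tail (proj₁ (proj₂ (AllPairs-++⁻ ps (subst LeftMax (++-assoc ps _ ys) lm)))))
          (Linked.tail (Linked-++⁻ʳ ps (subst Ascent (++-assoc ps _ ys) asc))) bs≤m m<ys r))
      (sym (++-assoc ps (b ∷ τ′) ys)))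
    run⇒scan sp EQ lm asc _ m<ys (enqueue r) = pick⇒scan sp EQ lm asc m<ys r

    pick⇒scan : ∀ {m Q bs τ ys w} → Interleaving Q bs τ → All (λ a → E a ≡ true) Q →
      LeftMax (τ ++ ys) → Ascent (τ ++ ys) → All (λ y → E y ≡ true → m < y) ys →
      Pick bs ys w → foldr slide (scan m w) Q ≡ τ ++ ys
    pick⇒scan {Q = Q} {τ = τ} sp EQ lm asc (m<y ∷ _) (pick {y = y} {ys} {w} Ey r)
      rewrite <⇒<ᵇ-true (m<y Ey) =
      -- The letter `y` slides before all letters of `Q` do, which makes it the last one in the
      -- queue.
      trans (sym (foldr-∷ʳ slide (scan y w) y Q)) (trans
        (run⇒scan (interleave-∷ʳˡ y sp) (All.∷ʳ⁺ EQ Ey)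
          (subst LeftMax (sym (∷ʳ-++ τ y ys)) lm) (subst Ascent (sym (∷ʳ-++ τ y ys)) asc)
          (interleave-Allʳ sp (All.map (λ x<y → <⇒≤ (x<y Ey)) (AllPairs-before τ lm)))
          (AllPairs-after τ lm) r)
        (∷ʳ-++ τ y ys))
    pick⇒scan {τ = τ} sp EQ lm asc (_ ∷ m<ys) (skip {y = y} {ys} r) = trans
      (pick⇒scan (interleave-∷ʳʳ y sp) EQ
        (subst LeftMax (sym (∷ʳ-++ τ y ys)) lm) (subst Ascent (sym (∷ʳ-++ τ y ys)) asc) m<ys r)
      (∷ʳ-++ τ y ys)

  pick-at : ∀ {bs} xs {y ys w} → E y ≡ true → Run (bs ++ xs) ys w → Pick bs (xs ++ y ∷ ys) (y ∷ w)
  pick-at {bs} []       {ys = ys} {w} Ey r = pick Ey (subst (λ l → Run l ys w) (++-identityʳ bs) r)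
  pick-at {bs} (x ∷ xs) {ys = ys} {w} Ey r =
    skip (pick-at xs Ey (subst (λ l → Run l ys w) (sym (∷ʳ-++ bs x xs)) r))

  mutual
    run-↭ : ∀ {bs ys w} → Run bs ys w → w ↭ bs ++ ys
    run-↭ done        = ↭-refl
    run-↭ (bypass r)  = prep _ (run-↭ r)
    run-↭ (enqueue r) = pick-↭ r

    pick-↭ : ∀ {bs ys w} → Pick bs ys w → w ↭ bs ++ ys
    pick-↭ {bs} (pick {y = y} {ys} _ r) = ↭-trans (prep y (run-↭ r)) (↭-sym (shift y bs ys))
    pick-↭ {bs} (skip {y = y} {ys} r) = subst (_ ↭_) (∷ʳ-++ bs y ys) (pick-↭ r)

  -- Converse to `LeftMax` and `Ascent`. At the end of the word the condition on the successor is
  -- vacuous.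
  Eligible : ℕ → List ℕ → Set
  Eligible m ys = ∀ {α x β} → ys ≡ α ++ x ∷ β → m < x → All (_< x) α → Maybe.All (x ≤_) (head β) → E x ≡ true

  -- A queued letter `m` cannot leave before a later letter `x ≤ m`. Peeling queued letters off the
  -- output therefore reaches a pending letter before `m`, and by `slides-head` and distinctness
  -- this letter is `x`.
  slides-bypass⁻ : ∀ {m x zs bs Q τ ys} → Interleaving Q bs τ → All (λ a → E a ≡ true) Q →
    LeftMax (τ ++ ys) → Unique (τ ++ ys) → m ∈ Q → x ≤ m →
    foldr slide (x ∷ zs) Q ≡ τ ++ ys →
    ∃ λ bs′ → bs ≡ x ∷ bs′ × ∃ λ (s : Bypassed x bs′ Q τ) →
      m ∈ Bypassed.queue s × foldr slide zs (Bypassed.queue s) ≡ Bypassed.target s ++ ys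
  slides-bypass⁻ {x = x} {zs} {Q = a ∷ Q} (consˡ sp) _ _ (a∉ ∷ _) (here refl) x≤a eq
    with foldr slide (x ∷ zs) Q in eq′
  ... | []     = contradiction (trans (sym (cong length eq′)) (trans (slides-length Q (x ∷ zs)) (+-suc _ _))) λ ()
  ... | y ∷ _ with slides-head x zs Q eq′ | y <? a
  -- If `a`, which is `m`, came first in τ, then a smaller `y` would be output before it, and
  -- `y ≡ a` would repeat a letter.
  ... | y≤x , _ | yes y<a rewrite <⇒<ᵇ-true y<a = contradiction (∷-injectiveˡ eq) (<⇒≢ y<a)
  ... | y≤x , _ | no y≮a rewrite ≤⇒<ᵇ-false (≮⇒≥ y≮a) =
    contradiction (≤-antisym (≮⇒≥ y≮a) (≤-trans y≤x x≤a))
      (All.lookup a∉ (subst (y ∈_) (∷-injectiveʳ eq) (here refl)))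
  slides-bypass⁻ {x = x} {zs} {Q = a ∷ Q} (consˡ sp) (_ ∷ EQ) (_ ∷ lm) (_ ∷ u) (there m∈Q) x≤m eq
    with slides-bypass⁻ sp EQ lm u m∈Q x≤m (slide-∷-injective (foldr slide (x ∷ zs) Q) eq)
  ... | bs′ , refl , bypassed ps sp′ refl EQ′ , m∈ , eq′ = bs′ , refl , bypassed (a ∷ ps) sp′ refl EQ′ , m∈ , eq′
  slides-bypass⁻ {x = x} {zs} {Q = Q} {τ = _ ∷ τ} (consʳ sp) EQ (lm ∷ _) (b∉ ∷ _) m∈Q x≤m eq
    with slides-head x zs Q eq
  ... | _ , inj₂ b∈Q  = contradiction refl (All.lookup (interleave-Allˡ sp (All.++⁻ˡ τ b∉)) b∈Q)
  ... | _ , inj₁ refl = _ , refl , bypassed [] sp refl EQ , m∈Q ,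
    ∷-injectiveʳ (trans (sym (slide-past zs (before-all sp EQ lm))) eq)

  ∈-slide : ∀ {x a} zs → x ∈ zs → x ∈ slide a zs
  ∈-slide {a = a} (z ∷ zs) x∈ with z <ᵇ a | x∈
  ... | true  | here refl  = here refl
  ... | true  | there x∈zs = there (∈-slide zs x∈zs)
  ... | false | _          = there x∈

  ∈-slides : ∀ {x} Q zs → x ∈ zs → x ∈ foldr slide zs Q
  ∈-slides []      zs x∈ = x∈
  ∈-slides (a ∷ Q) zs x∈ = ∈-slide (foldr slide zs Q) (∈-slides Q zs x∈)

  -- The run is recovered by reading `w`. The bound `m` is 0 at the start and then the last letter
  -- to have entered, which is still in the queue.
  scan⇒run : ∀ {m Q bs τ ys} w → Interleaving Q bs τ → All (λ a → E a ≡ true) Q →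
    LeftMax (τ ++ ys) → Unique (τ ++ ys) → All (0 <_) (τ ++ ys) → All (_≤ m) τ → m ≡ 0 ⊎ m ∈ Q →
    Eligible m ys → foldr slide (scan m w) Q ≡ τ ++ ys → Run bs ys w
  -- At the end of the input only the queue is output, so comparing lengths leaves no pending and no
  -- remaining letters.
  scan⇒run {Q = Q} {bs} {τ} {ys} [] sp _ _ _ _ _ _ _ eq = finish bs ys lengths
    where
    lengths : length Q + 0 ≡ length Q + (length bs + length ys)
    lengths = begin
      length Q + 0                       ≡⟨ slides-length Q [] ⟨
      length (foldr slide [] Q)          ≡⟨ cong length eq ⟩
      length (τ ++ ys)                   ≡⟨ length-++ τ ⟩
      length τ + length ys               ≡⟨ cong (_+ length ys) (trans (↭-length (toPermutation sp)) (length-++ Q)) ⟩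
      length Q + length bs + length ys   ≡⟨ +-assoc (length Q) _ _ ⟩
      length Q + (length bs + length ys) ∎

    finish : ∀ bs ys → length Q + 0 ≡ length Q + (length bs + length ys) → Run bs ys []
    finish []      []      _ = done
    finish []      (_ ∷ _) l = contradiction (+-cancelˡ-≡ (length Q) _ _ l) λ ()
    finish (_ ∷ _) ys      l = contradiction (+-cancelˡ-≡ (length Q) _ _ l) λ ()
  scan⇒run {m} {Q} {bs} {τ} {ys} (x ∷ w) sp EQ lm u pos τ≤m m∈ el eq with m <? x
  ... | no m≮x rewrite ≤⇒<ᵇ-false (≮⇒≥ m≮x) with m∈
  ...   | inj₁ refl = contradiction (All.lookup pos (subst (x ∈_) eq (∈-slides Q _ (here refl)))) m≮x
  ...   | inj₂ m∈Q with slides-bypass⁻ sp EQ lm u m∈Q (≮⇒≥ m≮x) eq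
  ...   | bs′ , refl , bypassed {target = τ′} ps sp′ refl EQ′ , m∈Q′ , eq′ rewrite ++-assoc ps (x ∷ τ′) ys =
    bypass (scan⇒run w sp′ EQ′ (AllPairs.tail (proj₁ (proj₂ (AllPairs-++⁻ ps lm))))
      (AllPairs.tail (proj₁ (proj₂ (AllPairs-++⁻ ps u)))) (All.tail (All.++⁻ʳ ps pos))
      (All.tail (All.++⁻ʳ ps τ≤m)) (inj₂ m∈Q′) el eq′)
  -- A letter above `m` enters. All letters of τ are at most `m`, so `x` lies in `ys`; being settled
  -- there makes it eligible, and the letters `γ` before it become pending.
  scan⇒run {m} {Q} {bs} {τ} {ys} (x ∷ w) sp EQ lm u pos τ≤m m∈ el eq | yes m<x rewrite <⇒<ᵇ-true m<x
    with slides-settled (interleave-Allˡ sp (All.map (λ t≤m → ≤-<-trans t≤m m<x) τ≤m)) (slide-settled x (scan x w))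
  ... | settled {α} {β} split α<x x≤β
    with ++-split-at τ α (All.map (λ t≤m → <⇒≢ (≤-<-trans t≤m m<x)) τ≤m) (trans (sym eq) split)
  ... | γ , refl , refl =
    enqueue (pick-at γ Ex (scan⇒run w (interleave-∷ʳˡ x (interleave-++ʳ γ sp)) (All.∷ʳ⁺ EQ Ex)
      (subst LeftMax (sym regroup) lm) (subst Unique (sym regroup) u) (subst (All (0 <_)) (sym regroup) pos)
      (All.∷ʳ⁺ (All.map <⇒≤ α<x) ≤-refl) (inj₂ (∈-++⁺ʳ Q (here refl)))
      (λ { {α′} {x′} {β′} refl x<x′ α′<x′ → el (sym (++-assoc γ (x ∷ α′) (x′ ∷ β′))) (<-trans m<x x<x′)
             (All.++⁺ (All.map (λ y<x → <-trans y<x x<x′) (All.++⁻ʳ τ α<x)) (x<x′ ∷ α′<x′)) })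
      (trans (foldr-∷ʳ slide (scan x w) x Q) (trans eq (sym regroup)))))
    where
    Ex : E x ≡ true
    Ex = el refl m<x (All.++⁻ʳ τ α<x) x≤β

    regroup : ((τ ++ γ) ∷ʳ x) ++ β ≡ τ ++ (γ ++ x ∷ β)
    regroup = trans (∷ʳ-++ (τ ++ γ) x β) (++-assoc τ γ (x ∷ β))

-- 321-avoiding permutations

¬T⇒T-not : ∀ {b} → ¬ T b → T (not b)
¬T⇒T-not {false} _  = _
¬T⇒T-not {true}  ¬t = ¬t _

T-not⇒¬T : ∀ {b} → T (not b) → ¬ T b
T-not⇒¬T {false} _ ()

∈-range⁺ : ∀ {a b x} → a ≤ x → x ≤ b → x ∈ range a b
∈-range⁺ {a} {b} {x} a≤x x≤b = subst (_∈ range a b) (m+[n∸m]≡n a≤x)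
  (∈-applyUpTo⁺ (a +_) (∸-monoˡ-< (s≤s x≤b) a≤x))

∈-range⁻ : ∀ {a b x} → x ∈ range a b → a ≤ x × x ≤ b
∈-range⁻ {a} {b} x∈ with ∈-applyUpTo⁻ (a +_) x∈
... | i , i< , refl = m≤m+n a i ,
  s≤s⁻¹ (subst (a + i <_) (m+[n∸m]≡n (<⇒≤ (m∸n≢0⇒n<m {suc b} {a} (m<n⇒n≢0 {i} {suc b ∸ a} i<))))
    (+-monoʳ-< a i<))

any-range⁺ : ∀ (p : ℕ → Bool) {a b x} → a ≤ x → x ≤ b → T (p x) → T (any p (range a b))
any-range⁺ p a≤x x≤b px = Any.any⁺ p (lose (∈-range⁺ a≤x x≤b) px)

any-range⁻ : ∀ (p : ℕ → Bool) a b → T (any p (range a b)) → ∃ λ x → a ≤ x × x ≤ b × T (p x)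
any-range⁻ p a b t with find (Any.any⁻ p (range a b) t)
... | x , x∈ , px = x , proj₁ (∈-range⁻ x∈) , proj₂ (∈-range⁻ x∈) , px

Avoids321 : List ℕ → Set
Avoids321 w = ∀ i j k → i < j → j < k → k < length w →
  at w (suc j) < at w (suc i) → ¬ at w (suc k) < at w (suc j)

avoids321⇒ : ∀ w → T (avoids321 (length w) w) → Avoids321 w
avoids321⇒ w t i j k i<j j<k k<n wj<wi wk<wj = T-not⇒¬T t
  (any-range⁺ _ (s≤s z≤n) (<-trans i<j (<-trans j<k k<n))
    (any-range⁺ _ (s≤s i<j) (<-trans j<k k<n)
      (any-range⁺ _ (s≤s j<k) k<n (from T-∧ (<⇒<ᵇ wj<wi , <⇒<ᵇ wk<wj)))))

avoids321⇐ : ∀ w → Avoids321 w → T (avoids321 (length w) w)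
avoids321⇐ w av = ¬T⇒T-not pattern⇒⊥
  where
  pattern⇒⊥ : ¬ T (any _ (range 1 (length w)))
  pattern⇒⊥ t with any-range⁻ _ 1 (length w) t
  ... | suc i , _ , _ , t₁ with any-range⁻ _ (suc (suc i)) (length w) t₁
  ... | suc j , s≤s i<j , _ , t₂ with any-range⁻ _ (suc (suc j)) (length w) t₂
  ... | suc k , s≤s j<k , k<n , t₃ with to T-∧ t₃
  ... | wj<wi , wk<wj = av i j k i<j j<k k<n (<ᵇ⇒< _ _ wj<wi) (<ᵇ⇒< _ _ wk<wj)

-- m plays the role of the maximum of the letters preceding w.
data Avoiding (m : ℕ) : List ℕ → Set where
  []   : Avoiding m []
  rise : ∀ {x w} → m < x → Avoiding x w → Avoiding m (x ∷ w)
  fall : ∀ {x w} → x < m → All (x <_) w → Avoiding m w → Avoiding m (x ∷ w)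

-- Concerns the 321 patterns in which `m`, put in front of `w`, is the largest letter.
AvoidsFrom : ℕ → List ℕ → Set
AvoidsFrom m w = ∀ j k → j < k → k < length w → at w (suc j) < m → ¬ at w (suc k) < at w (suc j)

avoiding⁺ : ∀ m w → Unique w → All (m ≢_) w → AvoidsFrom m w → Avoids321 w → Avoiding m w
avoiding⁺ m []      _          _          _  _  = []
avoiding⁺ m (x ∷ w) (x∉ ∷ u) (m≢x ∷ m∉) af av with m <? x
... | yes m<x = rise m<x (avoiding⁺ x w u x∉
  (λ j k j<k k<n → av 0 (suc j) (suc k) z<s (s<s j<k) (s<s k<n))
  (λ i j k i<j j<k k<n → av (suc i) (suc j) (suc k) (s<s i<j) (s<s j<k) (s<s k<n)))
... | no m≮x = fall x<m
  (all-at⇒All w λ k k<n → ≤∧≢⇒< (≮⇒≥ (af 0 (suc k) z<s (s<s k<n) x<m)) (All-at x∉ k<n))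
  (avoiding⁺ m w u m∉
    (λ j k j<k k<n → af (suc j) (suc k) (s<s j<k) (s<s k<n))
    (λ i j k i<j j<k k<n → av (suc i) (suc j) (suc k) (s<s i<j) (s<s j<k) (s<s k<n)))
  where
  x<m : x < m
  x<m = ≤∧≢⇒< (≮⇒≥ m≮x) (m≢x ∘ sym)

avoiding⇒from : ∀ {m w} → Avoiding m w → AvoidsFrom m w
avoiding⇒from (rise m<x av)    zero    (suc k) _         (s<s k<n) x<m  = contradiction x<m (<-asym m<x)
avoiding⇒from (rise m<x av)    (suc j) (suc k) (s<s j<k) (s<s k<n) wj<m =
  avoiding⇒from av j k j<k k<n (<-trans wj<m m<x)
avoiding⇒from (fall x<m x< av) zero    (suc k) _         (s<s k<n) _    = <-asym (All-at x< k<n)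
avoiding⇒from (fall x<m x< av) (suc j) (suc k) (s<s j<k) (s<s k<n) wj<m = avoiding⇒from av j k j<k k<n wj<m

avoiding⇒321 : ∀ {m w} → Avoiding m w → Avoids321 w
avoiding⇒321 (rise m<x av) zero (suc j) (suc k) _ (s<s j<k) (s<s k<n) = avoiding⇒from av j k j<k k<n
avoiding⇒321 (rise m<x av) (suc i) (suc j) (suc k) (s<s i<j) (s<s j<k) (s<s k<n) =
  avoiding⇒321 av i j k i<j j<k k<n
avoiding⇒321 (fall x<m x< av) zero (suc j) (suc k) _ (s<s j<k) (s<s k<n) wj<x =
  contradiction wj<x (<-asym (All-at x< (<-trans j<k k<n)))
avoiding⇒321 (fall x<m x< av) (suc i) (suc j) (suc k) (s<s i<j) (s<s j<k) (s<s k<n) =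
  avoiding⇒321 av i j k i<j j<k k<n

open Runs allEligible using (Run; Pick; done; bypass; enqueue; pick; skip)

-- For increasing output a bypassing letter is the least one left, so it is never the middle of a
-- 321 pattern.
mutual
  run⇒avoiding : ∀ {m bs ys w} → AllPairs _<_ (bs ++ ys) → All (_< m) bs → All (m <_) ys →
                 Run bs ys w → Avoiding m w
  run⇒avoiding s        _            _    done        = []
  run⇒avoiding (b< ∷ s) (b<m ∷ bs<m) m<ys (bypass r)  =
    fall b<m (All-resp-↭ (↭-sym (run-↭ allEligible r)) b<) (run⇒avoiding s bs<m m<ys r)
  run⇒avoiding s        _            m<ys (enqueue r) = pick⇒avoiding s m<ys r

  pick⇒avoiding : ∀ {m bs ys w} → AllPairs _<_ (bs ++ ys) → All (m <_) ys → Pick bs ys w → Avoiding m w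
  pick⇒avoiding {bs = bs} s (m<y ∷ m<ys) (pick _ r) =
    rise m<y (run⇒avoiding (AllPairs-delete bs s) (AllPairs-before bs s) (AllPairs-after bs s) r)
  pick⇒avoiding {bs = bs} {y ∷ ys} s (m<y ∷ m<ys) (skip r) =
    pick⇒avoiding (subst (AllPairs _<_) (sym (++-assoc bs (y ∷ []) ys)) s) m<ys r

-- A letter above `m` is remaining and may enter. A letter below `m` is pending, and it is the first
-- pending one: a smaller pending letter would come later in `w`, against `fall`.
avoiding⇒run : ∀ {m w} bs ys → Avoiding m w → w ↭ bs ++ ys → AllPairs _<_ (bs ++ ys) →
               All (_< m) bs → All (m <_) ys → Run bs ys w
avoiding⇒run bs ys [] w↭ s bs<m m<ys with bs | ys | ↭-empty-inv (↭-sym w↭)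
... | [] | [] | refl = done
avoiding⇒run bs ys (rise {x} {w} m<x av) w↭ s bs<m m<ys with ∈-++⁻ bs (∈-resp-↭ w↭ (here refl))
... | inj₁ x∈bs = contradiction (All.lookup bs<m x∈bs) (<-asym m<x)
... | inj₂ x∈ys with ∈-∃++ x∈ys
... | pre , post , refl = enqueue (pick-at allEligible pre refl
  (avoiding⇒run (bs ++ pre) post av (drop-mid [] (bs ++ pre) (subst (x ∷ w ↭_) (sym (++-assoc bs pre _)) w↭))
    (AllPairs-delete (bs ++ pre) s′) (AllPairs-before (bs ++ pre) s′) (AllPairs-after (bs ++ pre) s′)))
  where
  s′ : AllPairs _<_ ((bs ++ pre) ++ x ∷ post)
  s′ = subst (AllPairs _<_) (sym (++-assoc bs pre _)) s
avoiding⇒run bs ys (fall x<m x< av) w↭ s bs<m m<ys with ∈-++⁻ bs (∈-resp-↭ w↭ (here refl))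
avoiding⇒run bs ys (fall x<m x< av) w↭ s bs<m m<ys | inj₂ x∈ys = contradiction (All.lookup m<ys x∈ys) (<-asym x<m)
avoiding⇒run (b ∷ bs) ys (fall x<m x< av) w↭ (_ ∷ s) (_ ∷ bs<m) m<ys | inj₁ (here refl) =
  bypass (avoiding⇒run bs ys av (drop-∷ w↭) s bs<m m<ys)
avoiding⇒run (b ∷ bs) ys (fall x<m x< av) w↭ (b< ∷ s) bs<m m<ys | inj₁ (there x∈bs)
  with ∈-resp-↭ (↭-sym w↭) (here refl)
... | here refl = contradiction (All.lookup b< (∈-++⁺ˡ x∈bs)) (<-irrefl refl)
... | there b∈w = contradiction (All.lookup x< b∈w) (<-asym (All.lookup b< (∈-++⁺ˡ x∈bs)))

-- Permutations as rearrangements of 1, ..., n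

Unique-resp-↭ : ∀ {xs ys : List ℕ} → xs ↭ ys → Unique xs → Unique ys
Unique-resp-↭ p = PermutationSetoid.Unique-resp-↭ (setoid ℕ) (↭⇒↭ₛ p)

-- Pigeonhole principle, for `isPerm` tests just the length and the occurrence of every value.
⊆∧length⇒↭ : ∀ {xs ys : List ℕ} → Unique xs → All (_∈ ys) xs → length xs ≡ length ys → xs ↭ ys
⊆∧length⇒↭ {[]}     {[]} _ _ _ = ↭-refl
⊆∧length⇒↭ {x ∷ xs} {ys} (x∉ ∷ u) (x∈ ∷ xs⊆) l with ∈-∃++ x∈
... | pre , post , refl = ↭-trans
  (prep x (⊆∧length⇒↭ u (All.tabulate λ {z} z∈ → remove (All.lookup x∉ z∈) (All.lookup xs⊆ z∈))
    (suc-injective (trans l (↭-length (shift x pre post))))))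
  (↭-sym (shift x pre post))
  where
  remove : ∀ {z} → x ≢ z → z ∈ pre ++ x ∷ post → z ∈ pre ++ post
  remove x≢z z∈ with ∈-++⁻ pre z∈
  ... | inj₁ z∈pre          = ∈-++⁺ˡ z∈pre
  ... | inj₂ (here refl)    = contradiction refl x≢z
  ... | inj₂ (there z∈post) = ∈-++⁺ʳ pre z∈post

range-sorted : ∀ n → AllPairs _<_ (range 1 n)
range-sorted n = AllPairs.applyUpTo⁺₁ suc n λ i<j _ → s<s i<j

range-unique : ∀ n → Unique (range 1 n)
range-unique n = AllPairs.map <⇒≢ (range-sorted n)

length-range : ∀ n → length (range 1 n) ≡ n
length-range n = length-applyUpTo suc n

range-positive : ∀ n → All (0 <_) (range 1 n)
range-positive n = All.applyUpTo⁺₂ suc n λ _ → z<s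

isPerm⇒↭ : ∀ n w → T (isPerm n w) → w ↭ range 1 n
isPerm⇒↭ n w t with to T-∧ t
... | t₁ , t₂ = ↭-sym (⊆∧length⇒↭ (range-unique n)
  (All.map (λ {v} t₃ → hit v (Any.any⁻ _ w t₃)) (All.all⁺ _ (range 1 n) t₂))
  (trans (length-range n) (sym (≡ᵇ⇒≡ _ n t₁))))
  where
  hit : ∀ v {xs} → Any (λ x → T (x ≡ᵇ v)) xs → v ∈ xs
  hit v (here {x} p) = here (sym (≡ᵇ⇒≡ x v p))
  hit v (there p)    = there (hit v p)

↭⇒isPerm : ∀ n w → w ↭ range 1 n → T (isPerm n w)
↭⇒isPerm n w w↭ = from T-∧ (≡⇒≡ᵇ _ n (trans (↭-length w↭) (length-range n)) ,
  All.all⁻ _ (All.tabulate λ {v} v∈ → Any.any⁺ _ (lose (∈-resp-↭ (↭-sym w↭) v∈) (≡⇒≡ᵇ v v refl))))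

words-suc : ∀ n k → words n (suc k) ≡ cartesianProductWith _∷_ (range 1 n) (words n k)
words-suc n k = expand (range 1 n)
  where
  expand : ∀ xs → concatMap (λ x → map (x ∷_) (words n k)) xs ≡ cartesianProductWith _∷_ xs (words n k)
  expand []       = refl
  expand (x ∷ xs) = cong (map (x ∷_) (words n k) ++_) (expand xs)

words-unique : ∀ n k → Unique (words n k)
words-unique n zero    = [] ∷ []
words-unique n (suc k) rewrite words-suc n k =
  Unique.cartesianProductWith⁺ _∷_ ∷-injective (range-unique n) (words-unique n k)

∈-words : ∀ {n w} → All (_∈ range 1 n) w → w ∈ words n (length w)
∈-words []         = here refl
∈-words {n} {x ∷ w} (x∈ ∷ w⊆) rewrite words-suc n (length w) = ∈-cartesianProductWith⁺ _∷_ x∈ (∈-words w⊆)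

∈-Sn⁺ : ∀ {n w} → w ↭ range 1 n → w ∈ Sn n
∈-Sn⁺ {n} {w} w↭ = ∈-filter⁺ (T? ∘ isPerm n)
  (subst (λ k → w ∈ words n k) (trans (↭-length w↭) (length-range n))
    (∈-words (All.tabulate (∈-resp-↭ w↭))))
  (↭⇒isPerm n w w↭)

∈-Sn⁻ : ∀ {n w} → w ∈ Sn n → w ↭ range 1 n
∈-Sn⁻ {n} {w} w∈ = isPerm⇒↭ n w (proj₂ (∈-filter⁻ (T? ∘ isPerm n) {xs = words n n} w∈))

-- Duplicate-free lists with the same members are rearrangements of each other. Both the
-- 321-avoiding permutations and the preimages of π are matched with runs in this way.
filter-Sn-↭ : ∀ n (p : List ℕ → Bool) {ws} → Unique ws →
  (∀ {w} → w ∈ ws → w ↭ range 1 n × T (p w)) →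
  (∀ {w} → w ↭ range 1 n → T (p w) → w ∈ ws) →
  filterᵇ p (Sn n) ↭ ws
filter-Sn-↭ n p u ws⊆ ⊆ws = ∼bag⇒↭ (unique∧set⇒bag
  (Unique.filter⁺ (T? ∘ p) (Unique.filter⁺ (T? ∘ isPerm n) (words-unique n n))) u
  (mk⇔ (λ w∈ → let w∈Sn , pw = ∈-filter⁻ (T? ∘ p) {xs = Sn n} w∈ in ⊆ws (∈-Sn⁻ w∈Sn) pw)
       (λ w∈ → let w↭ , pw = ws⊆ w∈ in ∈-filter⁺ (T? ∘ p) (∈-Sn⁺ w↭) pw)))

count-↭ : ∀ (p : List ℕ → Bool) {xs ys} → xs ↭ ys → count p xs ≡ count p ys
count-↭ p xs↭ys = ↭-length (filter-↭ (T? ∘ p) xs↭ys)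

freeRuns-↭ : ∀ n {w} → w ∈ freeRuns [] (range 1 n) → w ↭ range 1 n
freeRuns-↭ n w∈ = run-↭ allEligible (Runs.∈-runs⁻ allEligible [] (range 1 n) w∈)

Sn321-↭ : ∀ n → Sn321 n ↭ freeRuns [] (range 1 n)
Sn321-↭ n = filter-Sn-↭ n (avoids321 n) (Runs.runs-unique allEligible [] (range 1 n) (range-unique n))
  (λ {w} w∈ → freeRuns-↭ n w∈ ,
    subst (λ l → T (avoids321 l w)) (trans (↭-length (freeRuns-↭ n w∈)) (length-range n))
      (avoids321⇐ w (avoiding⇒321 (run⇒avoiding (range-sorted n) [] (range-positive n)
        (Runs.∈-runs⁻ allEligible [] (range 1 n) w∈)))))
  (λ {w} w↭ t → Runs.∈-runs⁺ allEligible (avoiding⇒run [] (range 1 n)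
    (avoiding⁺ 0 w (Unique-resp-↭ (↭-sym w↭) (range-unique n))
      (All.map <⇒≢ (All-resp-↭ (↭-sym w↭) (range-positive n))) (λ _ _ _ _ ())
      (avoids321⇒ w (subst (λ l → T (avoids321 l w)) (sym (trans (↭-length w↭) (length-range n))) t)))
    w↭ (range-sorted n) [] (range-positive n)))

bb≡maxAt : ∀ n i → i < n → bb n (suc i) ≡ maxAt i 0 n
bb≡maxAt (suc n) i _ = begin
  count isMax (Sn321 (suc n))
    ≡⟨ count-↭ isMax (Sn321-↭ (suc n)) ⟩
  count isMax (freeRuns [] (range 1 (suc n)))
    ≡⟨ cong (count isMax ∘ freeRuns []) (sym (applyUpTo-∷ʳ suc n)) ⟩
  count isMax (freeRuns [] (range 1 n ∷ʳ suc n))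
    ≡⟨ count-maxIs {suc n} z<s i [] (All.applyUpTo⁺₁ suc n λ i<n → <⇒≢ (s<s i<n)) ⟩
  maxAt i 0 (suc (length (range 1 n)))
    ≡⟨ cong (maxAt i 0 ∘ suc) (length-range n) ⟩
  maxAt i 0 (suc n) ∎
  where
  isMax : List ℕ → Bool
  isMax = maxIs {suc n} z<s i

gg≡dropAt : ∀ n k → k < n → gg n (suc (suc k)) ≡ dropAt (suc k) 0 n
gg≡dropAt n k k<n with suc k ≟ n
-- The index is n + 1 here: the value 1 set by convention counts the run in which every letter
-- enters before any bypass.
... | yes refl rewrite ≡ᵇ-refl k = sym (dropAt-top (suc k))
... | no k≢n rewrite ≢⇒≡ᵇ-false k≢n = begin
  count _ (Sn321 n)
    ≡⟨ count-↭ _ (Sn321-↭ n) ⟩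
  count _ (freeRuns [] (range 1 n))
    ≡⟨ count-cong (freeRuns [] (range 1 n)) (λ w∈ → firstDrop-isLTRmax (suc k)
         (All-resp-↭ (↭-sym (freeRuns-↭ n w∈)) (range-positive n))
         (subst (suc k <_) (sym (trans (↭-length (freeRuns-↭ n w∈)) (length-range n))) (≤∧≢⇒< k<n k≢n))) ⟩
  count (λ w → firstDrop 0 w (suc k)) (freeRuns [] (range 1 n))
    ≡⟨ count-firstDrop (suc k) [] (range 1 n) (range-sorted n) [] (range-positive n) ⟩
  dropAt (suc k) 0 (length (range 1 n))
    ≡⟨ cong (dropAt (suc k) 0) (length-range n) ⟩
  dropAt (suc k) 0 n ∎

-- The decomposition M₁ P₁ M₂

<ᵇ-true⇒< : ∀ {m n} → (m <ᵇ n) ≡ true → m < n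
<ᵇ-true⇒< {m} {n} eq = <ᵇ⇒< m n (from T-≡ eq)

<ᵇ-false⇒≥ : ∀ {m n} → (m <ᵇ n) ≡ false → n ≤ m
<ᵇ-false⇒≥ {m} {n} eq = ≮⇒≥ λ m<n → contradiction (trans (sym eq) (<⇒<ᵇ-true m<n)) λ ()

-- The last of the `k + 1` maxima is kept apart as `top`, the later μ; it is the threshold for the
-- maxima of `rest`.
record Rise (m k : ℕ) (w : List ℕ) : Set where
  constructor mkRise
  field
    {xs}   : List ℕ
    {top}  : ℕ
    {rest} : List ℕ
    split  : w ≡ xs ++ top ∷ rest
    len    : length xs ≡ k
    incr   : AllPairs _<_ (m ∷ xs ∷ʳ top)
    after  : ∀ i → ltr m w (suc k + i) ≡ ltr top rest i

rises : ∀ k m w → k < length w → (∀ i → i ≤ k → ltr m w i ≡ true) → Rise m k w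
rises zero    m (x ∷ w) _ up = mkRise {xs = []} refl refl ((m<x ∷ []) ∷ [] ∷ []) (λ i → ltr-above w i (<⇒≤ m<x))
  where
  m<x : m < x
  m<x = <ᵇ-true⇒< (trans (sym (ltr-zero m x w)) (up 0 z≤n))
rises (suc k) m (x ∷ w) (s<s k<n) up with <ᵇ-true⇒< (trans (sym (ltr-zero m x w)) (up 0 z≤n))
... | m<x with rises k x w k<n (λ i i≤k → trans (sym (ltr-above w i (<⇒≤ m<x))) (up (suc i) (s≤s i≤k)))
... | mkRise split len incr@(x< ∷ _) sh = mkRise {xs = x ∷ _} (cong (x ∷_) split) (cong suc len)
  ((m<x ∷ All.map (<-trans m<x) x<) ∷ incr) (λ i → trans (ltr-above w (suc k + i) (<⇒≤ m<x)) (sh i))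

all-rise : ∀ m w → (∀ i → i < length w → ltr m w i ≡ true) → AllPairs _<_ (m ∷ w)
all-rise m []      up = [] ∷ []
all-rise m (x ∷ w) up with <ᵇ-true⇒< (trans (sym (ltr-zero m x w)) (up 0 z<s))
... | m<x with all-rise x w (λ i i<n → trans (sym (ltr-above w i (<⇒≤ m<x))) (up (suc i) (s<s i<n)))
... | incr@(x< ∷ _) = (m<x ∷ All.map (<-trans m<x) x<) ∷ incr

record Fall (m k : ℕ) (w : List ℕ) : Set where
  constructor mkFall
  field
    {ns rest} : List ℕ
    split  : w ≡ ns ++ rest
    len    : length ns ≡ k
    below  : All (_≤ m) ns
    after  : ∀ i → ltr m w (k + i) ≡ ltr m rest i

falls : ∀ k m w → k ≤ length w → (∀ i → i < k → ltr m w i ≡ false) → Fall m k w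
falls zero    m w       _ _ = mkFall {ns = []} refl refl [] λ _ → refl
falls (suc k) m (x ∷ w) (s≤s k≤n) low with <ᵇ-false⇒≥ (trans (sym (ltr-zero m x w)) (low 0 z<s))
... | x≤m with falls k m w k≤n (λ i i<k → trans (sym (ltr-below w i x≤m)) (low (suc i) (s<s i<k)))
... | mkFall split len below sh = mkFall {ns = x ∷ _} (cong (x ∷_) split) (cong suc len) (x≤m ∷ below)
  (λ i → trans (ltr-below w (k + i) x≤m) (sh i))

unique-split : ∀ {x : ℕ} α γ {β δ} → Unique (α ++ x ∷ β) → α ++ x ∷ β ≡ γ ++ x ∷ δ → α ≡ γ × β ≡ δ
unique-split []      []      _         eq = refl , ∷-injectiveʳ eq
unique-split []      (y ∷ γ) (x∉ ∷ _)  eq with ∷-injective eq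
... | refl , refl = contradiction refl (All.lookup x∉ (∈-++⁺ʳ γ (here refl)))
unique-split (y ∷ α) []      (y∉ ∷ _)  eq with ∷-injective eq
... | refl , _ = contradiction refl (All.lookup y∉ (∈-++⁺ʳ α (here refl)))
unique-split (y ∷ α) (z ∷ γ) (_ ∷ u)   eq with ∷-injective eq
... | refl , eq′ with unique-split α γ u eq′
... | refl , β≡δ = refl , β≡δ

module Decomposed {xs ns zs : List ℕ} {μ : ℕ}
  (u       : Unique (xs ++ μ ∷ ns ++ zs))
  (pos     : All (0 <_) (xs ++ μ ∷ ns ++ zs))
  (xs-incr : AllPairs _<_ (xs ∷ʳ μ))
  (ns≤μ    : All (_≤ μ) ns)
  (zs-incr : AllPairs _<_ (μ ∷ zs))
  (0<ns    : 0 < length ns)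
  where

  private
    π : List ℕ
    π = xs ++ μ ∷ ns ++ zs

  elig : ℕ → Bool
  elig x = not (does (x ∈? (μ ∷ ns)))

  ∉⇒elig : ∀ {x} → x ∉ μ ∷ ns → elig x ≡ true
  ∉⇒elig {x} x∉ = cong not (dec-false (x ∈? (μ ∷ ns)) x∉)

  ∈⇒¬elig : ∀ {x} → x ∈ μ ∷ ns → elig x ≡ false
  ∈⇒¬elig {x} x∈ = cong not (dec-true (x ∈? (μ ∷ ns)) x∈)

  ¬elig⇒ : ∀ {x} {P : Set} → x ∈ μ ∷ ns → elig x ≡ true → P
  ¬elig⇒ x∈ e = contradiction (trans (sym e) (∈⇒¬elig x∈)) λ ()

  ns<μ : All (_< μ) ns
  ns<μ with AllPairs-++⁻ xs u
  ... | _ , μ∉ ∷ _ , _ = All.zipWith (λ { (n≤μ , μ≢n) → ≤∧≢⇒< n≤μ (μ≢n ∘ sym) }) (ns≤μ , All.++⁻ˡ ns μ∉)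

  μns≤μ : All (_≤ μ) (μ ∷ ns)
  μns≤μ = ≤-refl ∷ ns≤μ

  xs<μ : All (_< μ) xs
  xs<μ = AllPairs-before xs xs-incr

  μ<zs : All (μ <_) zs
  μ<zs = AllPairs.head zs-incr

  elig-xs : All (λ x → elig x ≡ true) xs
  elig-xs with AllPairs-++⁻ xs u
  ... | _ , _ , xs∉ = All.map (λ x∉ → ∉⇒elig λ x∈ → All.lookup x∉ (∈-++⁺ˡ {ys = zs} x∈) refl) xs∉

  elig-zs : All (λ x → elig x ≡ true) zs
  elig-zs = All.map (λ μ<z → ∉⇒elig λ z∈ → <⇒≱ μ<z (All.lookup μns≤μ z∈)) μ<zs

  ¬elig-ns : All (λ x → elig x ≡ false) (μ ∷ ns)
  ¬elig-ns = All.tabulate ∈⇒¬elig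

  leftMax : LeftMax elig π
  leftMax = AllPairs.++⁺ (AllPairs.map (λ x<y _ → x<y) (proj₁ (AllPairs-++⁻ xs xs-incr)))
    (AllPairs.++⁺ {xs = μ ∷ ns} (low (μ ∷ ns) id) (AllPairs.map (λ x<y _ → x<y) (AllPairs.tail zs-incr))
      (All.map (λ n≤μ → All.map (λ μ<z _ → ≤-<-trans n≤μ μ<z) μ<zs) μns≤μ))
    (All.map (λ x<μ → All.++⁺ {xs = μ ∷ ns} (All.tabulate ¬elig⇒) (All.map (λ μ<z _ → <-trans x<μ μ<z) μ<zs)) xs<μ)
    where
    low : ∀ ls → (∀ {l} → l ∈ ls → l ∈ μ ∷ ns) → LeftMax elig ls
    low []       ⊆ = []
    low (l ∷ ls) ⊆ = All.tabulate (λ l∈ → ¬elig⇒ (⊆ (there l∈))) ∷ low ls (⊆ ∘ there)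

  ascent : Ascent elig π
  ascent = high xs xs-incr (low (μ ∷ ns) id)
    where
    Linked-∷ : ∀ {x l} → x ∈ μ ∷ ns → Ascent elig l → Ascent elig (x ∷ l)
    Linked-∷ {l = []}    _  _   = [-]
    Linked-∷ {l = _ ∷ _} x∈ asc = ¬elig⇒ x∈ ∷ asc

    low : ∀ ls → (∀ {l} → l ∈ ls → l ∈ μ ∷ ns) → Ascent elig (ls ++ zs)
    low []       ⊆ = Linked.map (λ x<y _ → x<y) (Linked.AllPairs⇒Linked (AllPairs.tail zs-incr))
    low (l ∷ ls) ⊆ = Linked-∷ (⊆ (here refl)) (low ls (⊆ ∘ there))

    high : ∀ xs {l} → AllPairs _<_ (xs ∷ʳ μ) → Ascent elig (μ ∷ l) → Ascent elig (xs ++ μ ∷ l)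
    high []           _                    asc = asc
    high (x ∷ [])     ((x<μ ∷ _) ∷ _)      asc = (λ _ → x<μ) ∷ asc
    high (x ∷ y ∷ xs) ((x<y ∷ _) ∷ incr) asc = (λ _ → x<y) ∷ high (y ∷ xs) incr asc

  -- μ is followed by a smaller letter, and the letters of ns are preceded by μ.
  eligible : Eligible elig 0 π
  eligible {α} {x} {β} eq _ α<x x≤β = ∉⇒elig λ { (here refl) → not-μ eq x≤β ; (there x∈) → not-ns x∈ eq α<x }
    where
    not-μ : ∀ {α β} → π ≡ α ++ μ ∷ β → ¬ Maybe.All (μ ≤_) (head β)
    not-μ {α} eq μ≤β with proj₂ (unique-split xs α u eq)
    ... | refl = head-ns 0<ns ns<μ μ≤β
      where
      head-ns : ∀ {ls} → 0 < length ls → All (_< μ) ls → ¬ Maybe.All (μ ≤_) (head (ls ++ zs))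
      head-ns _ (l<μ ∷ _) (just μ≤l) = <⇒≱ l<μ μ≤l

    not-ns : ∀ {x α β} → x ∈ ns → π ≡ α ++ x ∷ β → ¬ All (_< x) α
    not-ns {x} {α} {β} x∈ eq α<x with ∈-∃++ x∈
    ... | γ , δ , refl with unique-split (xs ++ μ ∷ γ) α (subst Unique regroup u) (trans (sym regroup) eq)
      where
      regroup : xs ++ μ ∷ (γ ++ x ∷ δ) ++ zs ≡ (xs ++ μ ∷ γ) ++ x ∷ (δ ++ zs)
      regroup = trans (cong (λ l → xs ++ μ ∷ l) (++-assoc γ (x ∷ δ) zs)) (sym (++-assoc xs (μ ∷ γ) _))
    ... | refl , _ = <⇒≱ (All.lookup α<x (∈-++⁺ʳ xs (here refl))) (All.lookup ns≤μ x∈)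

  open Runs elig using (runs; ∈-runs⁺; ∈-runs⁻; runs-unique; length-runs-pivot)

  listEq-refl : ∀ xs → T (listEq xs xs)
  listEq-refl []       = _
  listEq-refl (x ∷ xs) = from T-∧ (≡⇒≡ᵇ x x refl , listEq-refl xs)

  listEq⇒≡ : ∀ xs ys → T (listEq xs ys) → xs ≡ ys
  listEq⇒≡ []       []       _ = refl
  listEq⇒≡ (x ∷ xs) (y ∷ ys) t with to T-∧ t
  ... | t₁ , t₂ = cong₂ _∷_ (≡ᵇ⇒≡ x y t₁) (listEq⇒≡ xs ys t₂)

  -- At the start the queue is empty, nothing is pending and all of π remains, so `run⇒scan` and
  -- `scan⇒run` apply with `m = 0`.
  preimages-↭ : ∀ {n} → π ↭ range 1 n → filterᵇ (λ σ → listEq (q σ) π) (Sn n) ↭ runs [] π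
  preimages-↭ {n} π↭ = filter-Sn-↭ n (λ σ → listEq (q σ) π) (runs-unique [] π u)
    (λ {w} w∈ → let r = ∈-runs⁻ [] π w∈ ; w↭π = run-↭ elig r in
      ↭-trans w↭π π↭ ,
      subst (λ l → T (listEq l π))
        (sym (trans (q≡scan (All-resp-↭ (↭-sym w↭π) pos))
          (run⇒scan elig [] [] leftMax ascent [] (All.map (λ 0<y _ → 0<y) pos) r)))
        (listEq-refl π))
    (λ {w} w↭ t → ∈-runs⁺ (scan⇒run elig w [] [] leftMax u pos [] (inj₁ refl) eligible
      (trans (sym (q≡scan (All-resp-↭ (↭-sym w↭) (range-positive n)))) (listEq⇒≡ (q w) π t))))

  preimageCount≡U : ∀ {n} → π ↭ range 1 n →
    preimageCount n π ≡ Pivot.U (length (μ ∷ ns)) (length zs) 0 (length xs)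
  preimageCount≡U π↭ = trans (↭-length (preimages-↭ π↭)) (length-runs-pivot ¬elig-ns elig-zs [] elig-xs)

theorem4p16 : (n : ℕ) (π : List ℕ) (m₁ p₁ m₂ : ℕ) →
    T (isPerm n π) → LTRDecomp π m₁ p₁ m₂ → 1 ≤ m₂ →
    preimageCount n π ≡ rhs m₁ p₁ m₂
-- The first entry is always a left-to-right maximum, so M₁ cannot be empty.
theorem4p16 n π zero (suc p) m₂ _ d _ with LTRDecomp.nonltr-P₁ d 1 z<s (s≤s z≤n)
... | ()
theorem4p16 n π (suc m) p (suc k) perm d _ = proof (rises m 0 π m<n first)
  where
  open LTRDecomp d

  π↭ : π ↭ range 1 n
  π↭ = isPerm⇒↭ n π perm

  pos : All (0 <_) π
  pos = All-resp-↭ (↭-sym π↭) (range-positive n)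

  m<n : m < length π
  m<n = ≤-trans (≤-trans (m≤m+n (suc m) p) (m≤m+n (suc m + p) (suc k))) (≤-reflexive (sym len))

  first : ∀ i → i ≤ m → ltr 0 π i ≡ true
  first i i≤m = trans (sym (isLTRmax≡ltr pos (≤-<-trans i≤m m<n))) (to T-≡ (ltr-M₁ (suc i) z<s (s≤s i≤m)))

  second : ∀ i → i < p → ltr 0 π (suc m + i) ≡ false
  second i i<p = trans
    (sym (isLTRmax≡ltr pos (≤-trans (+-monoʳ-< (suc m) i<p) (≤-trans (m≤m+n (suc m + p) (suc k)) (≤-reflexive (sym len))))))
    (to T-not-≡ (nonltr-P₁ _ (s≤s (m≤m+n (suc m) i)) (+-monoʳ-< (suc m) i<p)))

  third : ∀ i → i < suc k → ltr 0 π (suc m + (p + i)) ≡ true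
  third i i<k rewrite sym (+-assoc m p i) = trans
    (sym (isLTRmax≡ltr pos (≤-trans (+-monoʳ-< (suc m + p) i<k) (≤-reflexive (sym len)))))
    (to T-≡ (ltr-M₂ _ (s≤s (m≤m+n (suc m + p) i)) (+-monoʳ-< (suc m + p) i<k)))

  proof : Rise 0 m π → preimageCount n π ≡ rhs (suc m) p (suc k)
  proof (mkRise {xs} {μ} {rest} refl |xs| (_ ∷ xs-incr) sh) =
    proof′ (falls p μ rest p≤ λ i i<p → trans (sym (sh i)) (second i i<p))
    where
    |rest| : length rest ≡ p + suc k
    |rest| = +-cancelˡ-≡ (suc m) _ _ (begin
      suc m + length rest           ≡⟨ cong (λ l → suc l + length rest) |xs| ⟨
      suc (length xs) + length rest ≡⟨ +-suc (length xs) (length rest) ⟨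
      length xs + suc (length rest) ≡⟨ length-++ xs ⟨
      length (xs ++ μ ∷ rest)       ≡⟨ len ⟩
      suc m + p + suc k             ≡⟨ +-assoc (suc m) p (suc k) ⟩
      suc m + (p + suc k)           ∎)

    p≤ : p ≤ length rest
    p≤ = ≤-trans (m≤m+n p (suc k)) (≤-reflexive (sym |rest|))

    proof′ : Fall μ p rest → preimageCount n (xs ++ μ ∷ rest) ≡ rhs (suc m) p (suc k)
    proof′ (mkFall {ns} {zs} refl |ns| ns≤μ sh′) = begin
      preimageCount n (xs ++ μ ∷ ns ++ zs)
        ≡⟨ Decomposed.preimageCount≡U (Unique-resp-↭ (↭-sym π↭) (range-unique n)) pos xs-incr ns≤μ
             (all-rise μ zs λ i i<n → trans (sym (trans (sh (p + i)) (sh′ i)))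
               (third i (subst (i <_) |zs| i<n)))
             (subst (0 <_) (sym |ns|) p₁>0) π↭ ⟩
      Pivot.U (suc (length ns)) (length zs) 0 (length xs)
        ≡⟨ cong₂ (λ a b → Pivot.U (suc a) b 0 (length xs)) |ns| |zs| ⟩
      Pivot.U (suc p) (suc k) 0 (length xs)
        ≡⟨ cong (Pivot.U (suc p) (suc k) 0) |xs| ⟩
      Pivot.U (suc p) (suc k) 0 m
        ≡⟨ rhs≡U bb≡maxAt gg≡dropAt p k m ⟨
      rhs (suc m) p (suc k) ∎
      where
      |zs| : length zs ≡ suc k
      |zs| = +-cancelˡ-≡ p _ _ (trans (cong (_+ length zs) (sym |ns|)) (trans (sym (length-++ ns)) |rest|))
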